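{- Let $\tilde h_n(q)=q^{n(n-1)/2}h_n(q^{ -1})$ for $n\ge 0$ and $\tilde h(q,s)=\sum_{n\ge0}\tilde h_n(q)s^n$. Then, as formal power series in $s$, $$\tilde h(q,s)=\cfrac{1}{1-\gamma_0 s-\cfrac{\lambda_0 s^2}{1-\gamma_1 s-\cfrac{\lambda_1 s^2}{1-\gamma_2 s-\cdots}}},\qquad \gamma_m=\binom{m+1}{1}_{\!q}^{2},\quad \lambda_m=q\binom{m+2}{2}_{\!q}^{2}\ (m\ge0),$$ i.e. $$\tilde h(q,s)=\cfrac{1}{1-s-\cfrac{qs^2}{1-\binom{2}{1}_q^2 s-\cfrac{q\binom{3}{2}_q^2s^2}{1-\binom{3}{1}_q^2s-\cfrac{q\binom{4}{2}_q^2s^2}{1-\binom{4}{1}_q^2 s-\cdots}}}}.$$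
   Context: Gaussian binomial coefficients: for $m\ge k\ge 0$, $\binom{m}{k}_q=\frac{[m]_q!}{[k]_q!\,[m-k]_q!}$ with $[m]_q!=\prod_{i=1}^m\frac{1-q^i}{1-q}$; set $\binom{m}{k}_q=0$ if $k>m$ or $k<0$. Let $W$ be an $n$-dimensional complex vector space with basis $w_1,\dots,w_n$, and $pr_k:W\to W$ the projection with $pr_k(\sum_i c_iw_i)=\sum_{i\ne k}c_iw_i$. The degenerate flag variety $\mathrm{Fl}^a_n$ is the variety of tuples $(V_1,\dots,V_{n-1})$ of subspaces of $W$ with $\dim V_k=k$ and $pr_{k+1}V_k\subset V_{k+1}$ for $k=1,\dots,n-2$. It admits a cellular decomposition into complex affine cells, so its Poincaré polynomial $P(t)$ involves only even powers of $t$; define $h_n(q)=P(q^{1/2})$, a polynomial of degree $n(n-1)/2$ with $h_0(q)=h_1(q)=1$. It is known (Cerulli Irelli–Feigin–Reineke) that $$h_n(q)=\sum_{f_1,\dots,f_{n-1}\ge 0} q^{\sum_{k=1}^{n-1}(k-f_k)(1-f_k+f_{k+1})}\prod_{k=1}^{n-1}\binom{1+f_{k-1}}{f_k}_{\!q}\prod_{k=1}^{n-1}\binom{1+f_{k+1}}{f_k}_{\!q},$$ with the convention $f_0=f_n=0$. -}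

module Defs where

open import Level using (Level; 0ℓ)
open import Algebra.Bundles using (RawRing)
import Algebra.Definitions.RawSemiring as RawSemiringDefs
open import Data.Bool.Base using (if_then_else_)
open import Data.Fin.Base using (toℕ)
open import Data.Integer.Base as ℤ using (ℤ; +_; -[1+_])
open import Data.Nat.Base as ℕ using (ℕ; zero; suc; _∸_; _≤ᵇ_; _≥_)
open import Data.Nat.DivMod using (_/_)
open import Data.Product.Base using (∃-syntax)
open import Data.Vec.Base using (Vec; []; _∷_)
open import Relation.Binary.PropositionalEquality.Core using (_≡_)

-- R[[X]]; a series is its coefficient sequence.
module PowerSeries {c ℓ : Level} (R : RawRing c ℓ) where

  private
    module R where
      open RawRing R public
      open RawSemiringDefs rawSemiring public using (sum)

  rawRing : RawRing c ℓ
  rawRing = record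
    { Carrier = ℕ → R.Carrier
    ; _≈_     = λ f g → ∀ n → f n R.≈ g n
    ; _+_     = λ f g n → f n R.+ g n
    ; _*_     = λ f g n → R.sum {suc n} λ i → f (toℕ i) R.* g (n ∸ toℕ i)
    ; -_      = λ f n → R.- f n
    ; 0#      = λ _ → R.0#
    ; 1#      = λ { zero → R.1# ; (suc _) → R.0# }
    }

  open RawRing rawRing public hiding (rawSemiring)
  open RawSemiringDefs (RawRing.rawSemiring rawRing) public
    using (_^_; product)

  infixl 6 _-_
  _-_ : Carrier → Carrier → Carrier
  f - g = f + (- g)

  const : R.Carrier → Carrier
  const a zero    = a
  const a (suc _) = R.0#

  X : Carrier
  X (suc zero) = R.1#
  X _          = R.0#

  -- The inverse of a series f with constant term 1 (it is used for no others):
  -- f⁻¹ = Σ_k (1 - f)^k, where (1 - f)^k has no terms of degree below k and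
  -- so does not contribute to the n-th coefficient when k > n.
  infix 9 _⁻¹
  _⁻¹ : Carrier → Carrier
  (f ⁻¹) n = R.sum {suc n} λ k → ((1# - f) ^ toℕ k) n

  infixl 7 _÷_
  _÷_ : Carrier → Carrier → Carrier
  f ÷ g = f * g ⁻¹

-- ℤ[[q]].  The denominators of the Gaussian binomials have constant term 1,
-- hence the quotients can be taken in this ring.
module Q = PowerSeries ℤ.+-*-rawRing

q : Q.Carrier
q = Q.X

[_]! : ℕ → Q.Carrier
[ m ]! = product {m} λ i → (1# - q ^ suc (toℕ i)) ÷ (1# - q)
  where open Q

binom : ℕ → ℕ → Q.Carrier
binom m k =
  if k ≤ᵇ m then [ m ]! ÷ ([ k ]! * [ m ∸ k ]!) else 0#
  where open Q

-- Two-sided coefficient sequences Σ_{j ∈ ℤ} u_j q^j, which contain both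
-- ℤ[[q]] and ℤ[q, q⁻¹].
TwoSided : Set
TwoSided = ℤ → ℤ

infix 4 _≋_
_≋_ : TwoSided → TwoSided → Set
u ≋ v = ∀ j → u j ≡ v j

ι : Q.Carrier → TwoSided
ι a (+ n)    = a n
ι a -[1+ n ] = ℤ.0ℤ

infixr 8 q^_·_
q^_·_ : ℤ → TwoSided → TwoSided
(q^ e · u) j = u (j ℤ.- e)

q↦q⁻¹ : TwoSided → TwoSided
q↦q⁻¹ u j = u (ℤ.- j)

private
  module ℤΣ = RawSemiringDefs (RawRing.rawSemiring ℤ.+-*-rawRing)

-- Σ over all (f₁ , … , f_l) ∈ {0 , … , B}^l
sumBox : (B l : ℕ) → (Vec ℕ l → TwoSided) → TwoSided
sumBox B zero    F   = F []
sumBox B (suc l) F j =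
  ℤΣ.sum {suc B} λ a → sumBox B l (λ f → F (toℕ a ∷ f)) j

-- f k is the entry f_k of f = (f₁ , … , f_l), with f_k = 0 for k = 0 and k > l.
entry : ∀ {l} → Vec ℕ l → ℕ → ℕ
entry _       zero          = 0
entry []      (suc _)       = 0
entry (a ∷ _) (suc zero)    = a
entry (_ ∷ f) (suc (suc k)) = entry f (suc k)

exponent : ∀ {l} → Vec ℕ l → ℤ
exponent {l} f = ℤΣ.sum {l} λ i →
  let k = suc (toℕ i) in
  (+ k ℤ.- + entry f k) ℤ.* (ℤ.1ℤ ℤ.- + entry f k ℤ.+ + entry f (suc k))

weight : ∀ {l} → Vec ℕ l → Q.Carrier
weight {l} f =
    product {l} (λ i → let k = suc (toℕ i) in
                       binom (1 ℕ.+ entry f (k ∸ 1)) (entry f k))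
  * product {l} (λ i → let k = suc (toℕ i) in
                       binom (1 ℕ.+ entry f (suc k)) (entry f k))
  where open Q

-- The Poincaré polynomial of the degenerate flag variety Fl^a_n (in q = t²),
-- given by the Cerulli Irelli–Feigin–Reineke formula.  There the sum is over
-- all f₁, …, f_{n-1} ≥ 0; since f₀ = 0 and binom (1 + f_{k-1}) f_k = 0 for
-- f_k > 1 + f_{k-1}, the weight vanishes unless every f_k ≤ k, so the box
-- {0 , … , n}^{n-1} contains all nonzero terms.
h : ℕ → TwoSided
h n = sumBox n (n ∸ 1) λ f → q^ exponent f · ι (weight f)

h̃ : ℕ → TwoSided
h̃ n = q^ + (n ℕ.* (n ∸ 1) / 2) · q↦q⁻¹ (h n)

-- ℤ[[q]][[s]]
module S = PowerSeries Q.rawRing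

-- The d-th convergent (the part below level d replaced by 0) of
--   1 / (1 - b_m s - c_m s² / (1 - b_{m+1} s - c_{m+1} s² / (1 - …)))
convergent : (b c : ℕ → Q.Carrier) → (m d : ℕ) → S.Carrier
convergent b c m zero    = S.0#
convergent b c m (suc d) =
  (1# - const (b m) * s - const (c m) * s ^ 2 * convergent b c (suc m) d) ⁻¹
  where
  open S
  s : Carrier
  s = X

-- The infinite continued fraction with coefficients b, c (starting at m = 0)
-- equals Σ_n u_n s^n: its convergents tend to this series s-adically, i.e.
-- each coefficient is eventually constant with value u_n.
JFraction≈ : (b c : ℕ → Q.Carrier) → (ℕ → TwoSided) → Set
JFraction≈ b c u =
  ∀ n → ∃[ D ] (∀ d → d ≥ D → ι (convergent b c 0 d n) ≋ u n)

γ : ℕ → Q.Carrier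
γ m = binom (m ℕ.+ 1) 1 Q.^ 2

λ′ : ℕ → Q.Carrier
λ′ m = q Q.* binom (m ℕ.+ 2) 2 Q.^ 2

{-# OPTIONS --safe #-}

-- Replacing q by q⁻¹ turns each Gaussian binomial into itself up to a power of
-- q.  Collecting the powers, h̃_n becomes the sum over f of
-- q^{Σ f_k (f_k − f_{k−1})} times the weight of f.  A nonzero weight forces
-- |f_k − f_{k−1}| ≤ 1, so f is a Motzkin path from height 0 to height 0; the
-- exponent is then the number of its rises, and the weight splits into one
-- factor per step: γ_a for a level step at height a, and λ_a for a rise from a
-- to a + 1 together with a fall from a + 1 to a.  The continued fraction is the
-- generating function of such paths.
module Submission where

open import Defs
open import Algebra.Bundles using (CommutativeRing; Monoid)
open import Data.Bool.Base using (true; false; T; if_then_else_)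
open import Data.Fin.Base as Fin using (Fin; toℕ)
open import Data.Integer.Base as ℤ using (ℤ; +_; -[1+_])
import Data.Integer.Properties as ℤ
open import Data.Integer.Tactic.RingSolver using (solve-∀)
open import Data.Nat.Base as ℕ using (ℕ; zero; suc; _∸_; _≤_; _<_; z≤n; s≤s; _≤ᵇ_)
open import Data.Nat.DivMod using (_/_; m*n/n≡m)
import Data.Nat.Properties as ℕ
import Data.Nat.Tactic.RingSolver as ℕ-Solver
open import Data.Product.Base using (_,_)
open import Data.Sum.Base using (_⊎_; inj₁; inj₂; [_,_]′)
open import Data.Vec.Base using (Vec; []; _∷_)
open import Function.Base using (_∘_)
open import Level using (Level)
open import Relation.Binary.Definitions using (tri<; tri≈; tri>)
open import Relation.Binary.PropositionalEquality as ≡ using (_≡_)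
open import Relation.Nullary.Decidable using (yes; no)
open import Relation.Nullary.Negation.Core using (¬_; contradiction)

-- Formal power series

-- The substitution q ↦ q⁻¹ does not act on ℤ[[q]], where the binomials live as quotients of series,
-- and two-sided sequences cannot be multiplied in general. Reversal is therefore a relation between
-- two series with a prescribed degree d, and its compatibility with products needs an argument of
-- its own. The degree is an integer: that of the binomial of m over k is k(m - k), negative exactly
-- when k > m, where the binomial is zero. The first product of binomials excludes f_k > f_{k-1} +
-- 1, the second f_k > f_{k+1} + 1. A single term f_k (f_k - f_{k-1}) is not the indicator of a
-- rise; along a path of nonzero weight it differs from it by an increment of f(f - 1)/2, and these
-- increments cancel because f_0 = f_n = 0. For other f the exponent need not count rises, so the
-- comparison always allows vanishing weight as the alternative.

module MonoidSums {c ℓ : Level} (M : Monoid c ℓ) where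
  open Monoid M
  open import Algebra.Properties.Monoid.Sum M using (sum)

  sum-snoc : ∀ n (v : ℕ → Carrier) → sum {suc n} (v ∘ toℕ) ≈ sum {n} (v ∘ toℕ) ∙ v n
  sum-snoc zero    v = trans (identityʳ (v 0)) (sym (identityˡ (v 0)))
  sum-snoc (suc n) v = trans (∙-congˡ {v 0} (sum-snoc n (v ∘ suc)))
    (sym (assoc (v 0) (sum {n} (v ∘ suc ∘ toℕ)) (v (suc n))))

  sum-zero : ∀ n (v : ℕ → Carrier) → (∀ k → k < n → v k ≈ ε) → sum {n} (v ∘ toℕ) ≈ ε
  sum-zero zero    v v≈0 = refl
  sum-zero (suc n) v v≈0 =
    trans (∙-cong (v≈0 0 (s≤s z≤n)) (sum-zero n (v ∘ suc) λ k k<n → v≈0 (suc k) (s≤s k<n)))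
          (identityˡ ε)

  sum-extend : ∀ {m n} → m ≤ n → (v : ℕ → Carrier) → (∀ k → m ≤ k → v k ≈ ε) →
               sum {n} (v ∘ toℕ) ≈ sum {m} (v ∘ toℕ)
  sum-extend {n = n} z≤n v v≈0 = sum-zero n v λ k _ → v≈0 k z≤n
  sum-extend (s≤s m≤n) v v≈0 = ∙-congˡ (sum-extend m≤n (v ∘ suc) λ k m≤k → v≈0 (suc k) (s≤s m≤k))

module SeriesRing {c ℓ : Level} (R : CommutativeRing c ℓ) where
  private module R = CommutativeRing R
  open R using (_≈_; 0#)
  open PowerSeries R.rawRing hiding (_≈_; 0#)
  private module P = PowerSeries R.rawRing
  open import Algebra.Properties.Semiring.Sum R.semiring using (sum; sum-cong-≋)
  open import Algebra.Solver.Ring.NaturalCoefficients.Default R.commutativeSemiring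
    using (solve; _:=_; _:+_; _:*_; con)
  open import Relation.Binary.Reasoning.Setoid R.setoid

  -- The convolution unfolds by its left factor: coefficient n + 1 of `f * g` is by definition
  -- `f 0 * g (suc n)` plus coefficient n of `tail f * g`. The ring laws are inductions along this
  -- recursion.
  tail : Carrier → Carrier
  tail f n = f (suc n)

  *-cong : ∀ {f f′ g g′} → f P.≈ f′ → g P.≈ g′ → f * g P.≈ f′ * g′
  *-cong f≈ g≈ n = sum-cong-≋ {suc n} λ i → R.*-cong (f≈ (toℕ i)) (g≈ (n ∸ toℕ i))

  -- The mirror recursion, which peels the constant term off the right factor; comparing it with the
  -- unfolding from the left yields commutativity.
  *-sucʳ : ∀ f g n → (f * g) (suc n) ≈ (f * tail g) n R.+ f (suc n) R.* g 0
  *-sucʳ f g zero    =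
    solve 2 (λ x y → x :+ (y :+ con 0) := (x :+ con 0) :+ y) R.refl _ _
  *-sucʳ f g (suc n) = begin
    f 0 R.* g (suc (suc n)) R.+ (tail f * g) (suc n)
      ≈⟨ R.+-congˡ (*-sucʳ (tail f) g n) ⟩
    f 0 R.* g (suc (suc n)) R.+ ((tail f * tail g) n R.+ f (suc (suc n)) R.* g 0)
      ≈⟨ R.+-assoc _ _ _ ⟨
    f 0 R.* g (suc (suc n)) R.+ (tail f * tail g) n R.+ f (suc (suc n)) R.* g 0 ∎

  *-comm : ∀ f g → f * g P.≈ g * f
  *-comm f g zero    = R.+-congʳ (R.*-comm _ _)
  *-comm f g (suc n) = begin
    f 0 R.* g (suc n) R.+ (tail f * g) n  ≈⟨ R.+-cong (R.*-comm _ _) (*-comm (tail f) g n) ⟩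
    g (suc n) R.* f 0 R.+ (g * tail f) n  ≈⟨ R.+-comm _ _ ⟩
    (g * tail f) n R.+ g (suc n) R.* f 0  ≈⟨ *-sucʳ g f n ⟨
    (g * f) (suc n)                       ∎

  *-distribʳ : ∀ h f g → (f + g) * h P.≈ f * h + g * h
  *-distribʳ h f g zero    =
    solve 3 (λ x y z → (x :+ y) :* z :+ con 0 := (x :* z :+ con 0) :+ (y :* z :+ con 0)) R.refl _ _ _
  *-distribʳ h f g (suc n) = begin
    (f 0 R.+ g 0) R.* h (suc n) R.+ ((tail f + tail g) * h) n
      ≈⟨ R.+-congˡ (*-distribʳ h (tail f) (tail g) n) ⟩
    (f 0 R.+ g 0) R.* h (suc n) R.+ ((tail f * h) n R.+ (tail g * h) n)
      ≈⟨ solve 5 (λ x y z u v → (x :+ y) :* z :+ (u :+ v) := (x :* z :+ u) :+ (y :* z :+ v)) R.refl _ _ _ _ _ ⟩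
    (f * h) (suc n) R.+ (g * h) (suc n) ∎

  scale-* : ∀ a f g → (λ n → a R.* f n) * g P.≈ λ n → a R.* (f * g) n
  scale-* a f g zero    =
    solve 3 (λ a x y → a :* x :* y :+ con 0 := a :* (x :* y :+ con 0)) R.refl _ _ _
  scale-* a f g (suc n) = begin
    a R.* f 0 R.* g (suc n) R.+ ((λ i → a R.* tail f i) * g) n
      ≈⟨ R.+-cong (R.*-assoc _ _ _) (scale-* a (tail f) g n) ⟩
    a R.* (f 0 R.* g (suc n)) R.+ a R.* (tail f * g) n
      ≈⟨ R.distribˡ _ _ _ ⟨
    a R.* (f * g) (suc n) ∎

  *-assoc : ∀ f g h → (f * g) * h P.≈ f * (g * h)
  *-assoc f g h zero    =
    solve 3 (λ x y z → (x :* y :+ con 0) :* z :+ con 0 := x :* (y :* z :+ con 0) :+ con 0) R.refl _ _ _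
  *-assoc f g h (suc n) = begin
    (f 0 R.* g 0 R.+ 0#) R.* h (suc n) R.+ (((λ i → f 0 R.* tail g i) + tail f * g) * h) n
      ≈⟨ R.+-congˡ (*-distribʳ h (λ i → f 0 R.* tail g i) (tail f * g) n) ⟩
    (f 0 R.* g 0 R.+ 0#) R.* h (suc n) R.+
      (((λ i → f 0 R.* tail g i) * h) n R.+ ((tail f * g) * h) n)
      ≈⟨ R.+-congˡ (R.+-cong (scale-* (f 0) (tail g) h n) (*-assoc (tail f) g h n)) ⟩
    (f 0 R.* g 0 R.+ 0#) R.* h (suc n) R.+
      (f 0 R.* (tail g * h) n R.+ (tail f * (g * h)) n)
      ≈⟨ solve 5 (λ x y z u v → (x :* y :+ con 0) :* z :+ (x :* u :+ v)
                  := x :* (y :* z :+ u) :+ v) R.refl _ _ _ _ _ ⟩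
    (f * (g * h)) (suc n) ∎

  0*≈0 : ∀ g → P.0# * g P.≈ P.0#
  0*≈0 g zero    = R.trans (R.+-identityʳ _) (R.zeroˡ _)
  0*≈0 g (suc n) = R.trans (R.+-cong (R.zeroˡ _) (0*≈0 g n)) (R.+-identityˡ _)

  *-identityˡ : ∀ g → 1# * g P.≈ g
  *-identityˡ g zero    = R.trans (R.+-identityʳ _) (R.*-identityˡ _)
  *-identityˡ g (suc n) =
    R.trans (R.+-cong (R.*-identityˡ _) (0*≈0 g n)) (R.+-identityʳ _)

  seriesRing : CommutativeRing c ℓ
  seriesRing = record
    { Carrier = Carrier ; _≈_ = P._≈_ ; _+_ = _+_ ; _*_ = _*_ ; -_ = -_ ; 0# = P.0# ; 1# = 1#
    ; isCommutativeRing = record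
      { isRing = record
        { +-isAbelianGroup = record
          { isGroup = record
            { isMonoid = record
              { isSemigroup = record
                { isMagma = record
                  { isEquivalence = record
                    { refl  = λ n → R.refl
                    ; sym   = λ p n → R.sym (p n)
                    ; trans = λ p r n → R.trans (p n) (r n)
                    }
                  ; ∙-cong = λ p r n → R.+-cong (p n) (r n)
                  }
                ; assoc = λ f g h n → R.+-assoc (f n) (g n) (h n)
                }
              ; identity = (λ f n → R.+-identityˡ (f n)) , (λ f n → R.+-identityʳ (f n))
              }
            ; inverse = (λ f n → R.-‿inverseˡ (f n)) , (λ f n → R.-‿inverseʳ (f n))
            ; ⁻¹-cong = λ p n → R.-‿cong (p n)
            }
          ; comm = λ f g n → R.+-comm (f n) (g n)
          }
        ; *-cong = *-cong
        ; *-assoc = *-assoc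
        ; *-identity = *-identityˡ , λ f n → R.trans (*-comm f 1# n) (*-identityˡ f n)
        ; distrib = (λ f g h n → R.trans (*-comm f (g + h) n)
                                   (R.trans (*-distribʳ f g h n)
                                     (R.+-cong (*-comm g f n) (*-comm h f n))))
                  , *-distribʳ
        }
      ; *-comm = *-comm
      }
    }

module Series {c ℓ : Level} (R : CommutativeRing c ℓ) where
  private module R = CommutativeRing R
  open SeriesRing R public using (seriesRing; tail)
  open CommutativeRing seriesRing hiding (_-_)
  open PowerSeries R.rawRing using (const; X; _⁻¹; _÷_; _-_; _^_)
  open import Algebra.Properties.Semiring.Sum R.semiring using (sum; sum-cong-≋)
  open import Algebra.Properties.Semiring.Sum semiring
    using (*-distribˡ-sum) renaming (sum to sumₛ)
  open import Algebra.Solver.Ring.NaturalCoefficients.Default commutativeSemiring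
    using (solve; _:=_; _:+_; _:*_; con)
  open import Relation.Binary.Reasoning.Setoid setoid
  open MonoidSums R.+-monoid using (sum-extend)

  const-*-coeff : ∀ a f n → (const a * f) n R.≈ a R.* f n
  const-*-coeff a f zero    = R.+-identityʳ _
  const-*-coeff a f (suc n) = R.trans (R.+-congˡ (zeroˡ f n)) (R.+-identityʳ _)

  X-*-zero : ∀ f → (X * f) 0 R.≈ R.0#
  X-*-zero f = R.trans (R.+-identityʳ _) (R.zeroˡ _)

  X-*-suc : ∀ f n → (X * f) (suc n) R.≈ f n
  X-*-suc f n = R.trans (R.+-cong (R.zeroˡ _) (*-congʳ {f} tail-X n))
                        (R.trans (R.+-identityˡ _) (*-identityˡ f n))
    where
    tail-X : tail X ≈ 1#
    tail-X zero    = R.refl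
    tail-X (suc _) = R.refl

  const-+-X-*-tail : ∀ f → f ≈ const (f 0) + X * tail f
  const-+-X-*-tail f zero    = R.sym (R.trans (R.+-congˡ (X-*-zero (tail f))) (R.+-identityʳ _))
  const-+-X-*-tail f (suc n) = R.sym (R.trans (R.+-congˡ (X-*-suc (tail f) n)) (R.+-identityˡ _))

  const-cong : ∀ {a b} → a R.≈ b → const a ≈ const b
  const-cong a≈b zero    = a≈b
  const-cong a≈b (suc _) = R.refl

  const-* : ∀ a b → const (a R.* b) ≈ const a * const b
  const-* a b zero    = R.sym (const-*-coeff a (const b) 0)
  const-* a b (suc n) = R.sym (R.trans (const-*-coeff a (const b) (suc n)) (R.zeroʳ _))

  *-cong-upTo : ∀ f {g h} n → (∀ i → i ≤ n → g i R.≈ h i) → (f * g) n R.≈ (f * h) n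
  *-cong-upTo f n g≈h = sum-cong-≋ {suc n} λ i → R.*-congˡ {f (toℕ i)} (g≈h (n ∸ toℕ i) (ℕ.m∸n≤m n (toℕ i)))

  ^-vanishes : ∀ {g} → g 0 R.≈ R.0# → ∀ {k n} → n < k → (g ^ k) n R.≈ R.0#
  ^-vanishes g₀≈0 {suc k} {zero}  _         =
    R.trans (R.+-identityʳ _) (R.trans (R.*-congʳ g₀≈0) (R.zeroˡ _))
  ^-vanishes {g} g₀≈0 {suc k} {suc n} (s≤s n<k) = R.trans
    (R.+-cong (R.trans (R.*-congʳ g₀≈0) (R.zeroˡ _))
      (R.trans (*-cong-upTo (tail g) {g ^ k} {0#} n λ i i≤n → ^-vanishes g₀≈0 (ℕ.≤-<-trans i≤n n<k))
               (zeroʳ (tail g) n)))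
    (R.+-identityʳ _)

  sum-coeff : ∀ {m} (v : Fin m → Carrier) n → sumₛ v n R.≈ sum λ i → v i n
  sum-coeff {zero}  v n = R.refl
  sum-coeff {suc m} v n = R.+-congˡ (sum-coeff (v ∘ Fin.suc) n)

  complement : ∀ f → f + (1# - f) ≈ 1#
  complement f n = R.trans (R.+-congˡ (R.+-comm _ _))
    (R.trans (R.sym (R.+-assoc _ _ _)) (R.trans (R.+-congʳ (R.-‿inverseʳ _)) (R.+-identityˡ _)))

  geometric : ∀ f n → f * sumₛ {n} (λ k → (1# - f) ^ toℕ k) + (1# - f) ^ n ≈ 1#
  geometric f zero    = trans (+-congʳ (zeroʳ f)) (+-identityˡ 1#)
  geometric f (suc n) = begin
    f * (1# + sumₛ {n} λ k → g * g ^ toℕ k) + g * g ^ n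
      ≈⟨ +-congʳ (*-congˡ {f} (+-congˡ (*-distribˡ-sum {n} g λ k → g ^ toℕ k))) ⟨
    f * (1# + g * Σ) + g * g ^ n
      ≈⟨ solve 4 (λ f g s p → f :* (con 1 :+ g :* s) :+ g :* p := f :+ g :* (f :* s :+ p)) refl f g Σ (g ^ n) ⟩
    f + g * (f * Σ + g ^ n)
      ≈⟨ +-congˡ (*-congˡ {g} (geometric f n)) ⟩
    f + g * 1#
      ≈⟨ +-congˡ (*-identityʳ g) ⟩
    f + g
      ≈⟨ complement f ⟩
    1# ∎
    where
    g = 1# - f
    Σ = sumₛ {n} λ k → g ^ toℕ k

  -- Coefficient n of the product sees the inverse only up to degree n, where it agrees with the sum
  -- of the first n + 1 powers of `1# - f`. By `geometric` the product with that sum misses 1 by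
  -- `(1# - f) ^ suc n`, which has no term of degree n.
  *-inverseʳ : ∀ {f} → f 0 R.≈ R.1# → f * f ⁻¹ ≈ 1#
  *-inverseʳ {f} f₀≈1 n = R.trans (*-cong-upTo f n truncate)
    (R.trans (R.sym (R.+-identityʳ _))
      (R.trans (R.+-congˡ (R.sym (^-vanishes g₀≈0 (ℕ.n<1+n n)))) (geometric f (suc n) n)))
    where
    g₀≈0 : (1# - f) 0 R.≈ R.0#
    g₀≈0 = R.trans (R.+-congˡ (R.-‿cong f₀≈1)) (R.-‿inverseʳ R.1#)
    truncate : ∀ i → i ≤ n → (f ⁻¹) i R.≈ sumₛ {suc n} (λ k → (1# - f) ^ toℕ k) i
    truncate i i≤n = R.sym (R.trans (sum-coeff {suc n} (λ k → (1# - f) ^ toℕ k) i)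
      (sum-extend (s≤s i≤n) (λ k → ((1# - f) ^ k) i) λ k i<k → ^-vanishes g₀≈0 i<k))

  ÷-unique : ∀ {f g h} → f 0 R.≈ R.1# → g * f ≈ h → h ÷ f ≈ g
  ÷-unique {f} {g} {h} f₀≈1 gf≈h = begin
    h * f ⁻¹        ≈⟨ *-congʳ gf≈h ⟨
    g * f * f ⁻¹    ≈⟨ *-assoc g f (f ⁻¹) ⟩
    g * (f * f ⁻¹)  ≈⟨ *-congˡ {g} (*-inverseʳ f₀≈1) ⟩
    g * 1#          ≈⟨ *-identityʳ g ⟩
    g               ∎

  *-coeff₀ : ∀ {f g} → f 0 R.≈ R.1# → g 0 R.≈ R.1# → (f * g) 0 R.≈ R.1#
  *-coeff₀ f₀≈1 g₀≈1 = R.trans (R.+-identityʳ _) (R.trans (R.*-cong f₀≈1 g₀≈1) (R.*-identityˡ _))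

  *-cancelʳ : ∀ {f g h} → f 0 R.≈ R.1# → g * f ≈ h * f → g ≈ h
  *-cancelʳ {f} {g} {h} f₀≈1 gf≈hf = trans (sym (÷-unique f₀≈1 gf≈hf)) (÷-unique f₀≈1 refl)

-- Gaussian binomials

if-true : ∀ {a} {A : Set a} {b} {x y : A} → T b → (if b then x else y) ≡ x
if-true {b = true} _ = ≡.refl

if-false : ∀ {a} {A : Set a} {b} {x y : A} → ¬ T b → (if b then x else y) ≡ y
if-false {b = true}  ¬t = contradiction _ ¬t
if-false {b = false} _  = ≡.refl

module GaussianBinomials {c ℓ : Level} (R : CommutativeRing c ℓ) where
  private module R = CommutativeRing R
  open Series R
  open CommutativeRing seriesRing hiding (_-_)
  open PowerSeries R.rawRing using (X; _⁻¹; _÷_; _-_; _^_; product)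
  open import Algebra.Properties.Semiring.Exp semiring using (^-homo-*)
  open MonoidSums *-monoid using (sum-snoc)
  open import Algebra.Properties.Group +-group using (∙-cancelʳ)
  open import Algebra.Solver.Ring.NaturalCoefficients.Default commutativeSemiring
    using (solve; _:=_; _:+_; _:*_; con)
  open import Relation.Binary.Reasoning.Setoid setoid

  qint : ℕ → Carrier
  qint n = (1# - X ^ n) ÷ (1# - X)

  qfact : ℕ → Carrier
  qfact m = product {m} λ i → qint (suc (toℕ i))

  1-X-coeff₀ : (1# - X) 0 R.≈ R.1#
  1-X-coeff₀ = R.trans (R.+-congˡ (R.trans (R.sym (R.+-identityˡ _)) (R.-‿inverseʳ _))) (R.+-identityʳ _)

  -- The power is kept on the left so that semiring identities suffice; by `qint-unique` this
  -- equation determines `qint n`.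
  qint-complement : ∀ n → qint n * (1# - X) + X ^ n ≈ 1#
  qint-complement n = begin
    qint n * d + X ^ n
      ≈⟨ +-congʳ (*-assoc (1# - X ^ n) (d ⁻¹) d) ⟩
    (1# - X ^ n) * (d ⁻¹ * d) + X ^ n
      ≈⟨ +-congʳ (*-congˡ {1# - X ^ n} (trans (*-comm (d ⁻¹) d) (*-inverseʳ 1-X-coeff₀))) ⟩
    (1# - X ^ n) * 1# + X ^ n
      ≈⟨ +-cong (*-identityʳ (1# - X ^ n)) refl ⟩
    (1# - X ^ n) + X ^ n
      ≈⟨ +-comm (1# - X ^ n) (X ^ n) ⟩
    X ^ n + (1# - X ^ n)
      ≈⟨ complement (X ^ n) ⟩
    1# ∎
    where d = 1# - X

  qint-unique : ∀ {f} n → f * (1# - X) + X ^ n ≈ 1# → f ≈ qint n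
  qint-unique {f} n eq = *-cancelʳ 1-X-coeff₀
    (∙-cancelʳ (X ^ n) (f * (1# - X)) (qint n * (1# - X)) (trans eq (sym (qint-complement n))))

  qint-1 : qint 1 ≈ 1#
  qint-1 = sym (qint-unique 1 (trans (+-cong (*-identityˡ (1# - X)) (*-identityʳ X))
    (trans (+-comm (1# - X) X) (complement X))))

  qint-+ : ∀ m n → qint (m ℕ.+ n) ≈ qint m + X ^ m * qint n
  qint-+ m n = sym (qint-unique (m ℕ.+ n) (begin
    (qint m + X ^ m * qint n) * d + X ^ (m ℕ.+ n)
      ≈⟨ +-congˡ (^-homo-* X m n) ⟩
    (qint m + X ^ m * qint n) * d + X ^ m * X ^ n
      ≈⟨ solve 5 (λ a x b d y → (a :+ x :* b) :* d :+ x :* y := a :* d :+ x :* (b :* d :+ y))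
           refl (qint m) (X ^ m) (qint n) d (X ^ n) ⟩
    qint m * d + X ^ m * (qint n * d + X ^ n)
      ≈⟨ +-congˡ (*-congˡ {X ^ m} (qint-complement n)) ⟩
    qint m * d + X ^ m * 1#
      ≈⟨ +-congˡ (*-identityʳ (X ^ m)) ⟩
    qint m * d + X ^ m
      ≈⟨ qint-complement m ⟩
    1# ∎))
    where d = 1# - X

  qint-coeff₀ : ∀ n → qint (suc n) 0 R.≈ R.1#
  qint-coeff₀ n = R.trans (qint-+ 1 n 0) (R.trans (R.+-cong (qint-1 0)
    (R.trans (*-congʳ {qint n} (*-identityʳ X) 0) (X-*-zero (qint n)))) (R.+-identityʳ _))

  qfact-suc : ∀ n → qfact (suc n) ≈ qfact n * qint (suc n)
  qfact-suc n = sum-snoc n (qint ∘ suc)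

  qfact-coeff₀ : ∀ n → qfact n 0 R.≈ R.1#
  qfact-coeff₀ zero    = R.refl
  qfact-coeff₀ (suc n) = R.trans (qfact-suc n 0)
    (*-coeff₀ {qfact n} {qint (suc n)} (qfact-coeff₀ n) (qint-coeff₀ n))

  -- gauss k j is the Gaussian binomial of k + j over k.
  gauss : ℕ → ℕ → Carrier
  gauss zero    j       = 1#
  gauss (suc k) zero    = 1#
  gauss (suc k) (suc j) = gauss k (suc j) + X ^ suc k * gauss (suc k) j

  gauss-zeroʳ : ∀ k → gauss k 0 ≈ 1#
  gauss-zeroʳ zero    = refl
  gauss-zeroʳ (suc k) = refl

  -- Induction along the q-Pascal rule: its two terms leave the factors `qint (suc k)` and
  -- `X ^ suc k * qint (suc j)`, which `qint-+` adds up to the top factor of the larger factorial.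
  gauss-* : ∀ k j → gauss k j * (qfact k * qfact j) ≈ qfact (k ℕ.+ j)
  gauss-* zero    j       = trans (*-identityˡ (1# * qfact j)) (*-identityˡ (qfact j))
  gauss-* (suc k) zero    = trans (*-identityˡ (qfact (suc k) * 1#))
    (trans (*-identityʳ (qfact (suc k))) (reflexive (≡.cong (qfact ∘ suc) (≡.sym (ℕ.+-identityʳ k)))))
  gauss-* (suc k) (suc j) = begin
    (G₁ + x * G₂) * (qfact (suc k) * qfact (suc j))
      ≈⟨ solve 5 (λ G₁ x G₂ a b → (G₁ :+ x :* G₂) :* (a :* b) := G₁ :* (a :* b) :+ x :* (G₂ :* (a :* b)))
           refl G₁ x G₂ (qfact (suc k)) (qfact (suc j)) ⟩
    G₁ * (qfact (suc k) * qfact (suc j)) + x * (G₂ * (qfact (suc k) * qfact (suc j)))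
      ≈⟨ +-cong (*-congˡ {G₁} (*-congʳ {qfact (suc j)} (qfact-suc k)))
                (*-congˡ {x} (*-congˡ {G₂} (*-congˡ {qfact (suc k)} (qfact-suc j)))) ⟩
    G₁ * (qfact k * a * qfact (suc j)) + x * (G₂ * (qfact (suc k) * (qfact j * b)))
      ≈⟨ solve 9 (λ G₁ x G₂ k a j j′ k′ b →
             G₁ :* (k :* a :* j′) :+ x :* (G₂ :* (k′ :* (j :* b)))
          := (G₁ :* (k :* j′)) :* a :+ (G₂ :* (k′ :* j)) :* (x :* b))
           refl G₁ x G₂ (qfact k) a (qfact j) (qfact (suc j)) (qfact (suc k)) b ⟩
    (G₁ * (qfact k * qfact (suc j))) * a + (G₂ * (qfact (suc k) * qfact j)) * (x * b)
      ≈⟨ +-cong (*-congʳ {a} (trans (gauss-* k (suc j)) (reflexive (≡.cong qfact (ℕ.+-suc k j)))))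
                (*-congʳ {x * b} (gauss-* (suc k) j)) ⟩
    qfact (suc (k ℕ.+ j)) * a + qfact (suc (k ℕ.+ j)) * (x * b)
      ≈⟨ distribˡ (qfact (suc (k ℕ.+ j))) a (x * b) ⟨
    qfact (suc (k ℕ.+ j)) * (a + x * b)
      ≈⟨ *-congˡ {qfact (suc (k ℕ.+ j))} (qint-+ (suc k) (suc j)) ⟨
    qfact (suc (k ℕ.+ j)) * qint (suc k ℕ.+ suc j)
      ≈⟨ reflexive (≡.cong (λ n → qfact n * qint (suc k ℕ.+ suc j)) (ℕ.+-suc k j)) ⟨
    qfact (k ℕ.+ suc j) * qint (suc k ℕ.+ suc j)
      ≈⟨ qfact-suc (k ℕ.+ suc j) ⟨
    qfact (suc k ℕ.+ suc j) ∎
    where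
    G₁ = gauss k (suc j)
    G₂ = gauss (suc k) j
    x = X ^ suc k
    a = qint (suc k)
    b = qint (suc j)

  qfact-*-coeff₀ : ∀ k j → (qfact k * qfact j) 0 R.≈ R.1#
  qfact-*-coeff₀ k j = *-coeff₀ {qfact k} {qfact j} (qfact-coeff₀ k) (qfact-coeff₀ j)

  -- The recursion for `gauss` treats k and j differently; the symmetry comes from the factorial
  -- formula, whose denominator can be cancelled.
  gauss-sym : ∀ k j → gauss k j ≈ gauss j k
  gauss-sym k j = *-cancelʳ (qfact-*-coeff₀ k j) (begin
    gauss k j * (qfact k * qfact j)  ≈⟨ gauss-* k j ⟩
    qfact (k ℕ.+ j)                  ≈⟨ reflexive (≡.cong qfact (ℕ.+-comm k j)) ⟩
    qfact (j ℕ.+ k)                  ≈⟨ gauss-* j k ⟨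
    gauss j k * (qfact j * qfact k)  ≈⟨ *-congˡ {gauss j k} (*-comm (qfact j) (qfact k)) ⟩
    gauss j k * (qfact k * qfact j)  ∎)

  gaussBinom : ℕ → ℕ → Carrier
  gaussBinom m k = if k ≤ᵇ m then qfact m ÷ (qfact k * qfact (m ∸ k)) else 0#

  gaussBinom-gauss : ∀ k j → gaussBinom (k ℕ.+ j) k ≈ gauss k j
  gaussBinom-gauss k j = begin
    gaussBinom (k ℕ.+ j) k
      ≡⟨ if-true (ℕ.≤⇒≤ᵇ (ℕ.m≤m+n k j)) ⟩
    qfact (k ℕ.+ j) ÷ (qfact k * qfact (k ℕ.+ j ∸ k))
      ≡⟨ ≡.cong (λ i → qfact (k ℕ.+ j) ÷ (qfact k * qfact i)) (ℕ.m+n∸m≡n k j) ⟩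
    qfact (k ℕ.+ j) ÷ (qfact k * qfact j)
      ≈⟨ ÷-unique (qfact-*-coeff₀ k j) (gauss-* k j) ⟩
    gauss k j ∎

  gaussBinom-zero : ∀ {m k} → m < k → gaussBinom m k ≈ 0#
  gaussBinom-zero {m} {k} m<k = reflexive (if-false λ k≤m → ℕ.<⇒≱ m<k (ℕ.≤ᵇ⇒≤ k m k≤m))

-- Continued fractions and Motzkin paths

module MotzkinPaths {c ℓ : Level} (R : CommutativeRing c ℓ)
                    (step : ℕ → ℕ → CommutativeRing.Carrier R) where
  private module R = CommutativeRing R

  descend : (ℕ → R.Carrier) → ℕ → R.Carrier
  descend f zero    = R.0#
  descend f (suc a) = step (suc a) a R.* f a

  -- Total weight of the n-step paths from height a to height 0, split by their first step. The zero
  -- value of `descend` at height 0 keeps them nonnegative.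
  motzkin : ℕ → ℕ → R.Carrier
  motzkin zero    zero    = R.1#
  motzkin zero    (suc a) = R.0#
  motzkin (suc n) a       =
    descend (motzkin n) a R.+ (step a a R.* motzkin n a R.+ step a (suc a) R.* motzkin n (suc a))

  open Series R
  open CommutativeRing seriesRing hiding (_-_)
  open PowerSeries R.rawRing using (const; X; _⁻¹; _-_; _^_)
  open import Algebra.Properties.Group +-group using (//-rightDividesˡ)
  open import Algebra.Solver.Ring.NaturalCoefficients.Default commutativeSemiring
    using (solve; _:=_; _:+_; _:*_; con)
  open import Relation.Binary.Reasoning.Setoid setoid

  -- Multiplying f + (u + v) = 1 by the inverse of f gives a fixed-point equation free of
  -- subtraction, the form that a decomposition of paths takes.
  *-inverse-unfold : ∀ {u v} → u 0 R.≈ R.0# → v 0 R.≈ R.0# →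
                     (1# - u - v) ⁻¹ ≈ 1# + (u + v) * (1# - u - v) ⁻¹
  *-inverse-unfold {u} {v} u₀≈0 v₀≈0 = begin
    C                      ≈⟨ *-identityˡ C ⟨
    1# * C                 ≈⟨ *-congʳ {C} split ⟨
    (f + (u + v)) * C      ≈⟨ distribʳ C f (u + v) ⟩
    f * C + (u + v) * C    ≈⟨ +-congʳ (*-inverseʳ f₀≈1) ⟩
    1# + (u + v) * C       ∎
    where
    f = 1# - u - v
    C = f ⁻¹
    split : f + (u + v) ≈ 1#
    split = begin
      f + (u + v)      ≈⟨ +-congˡ {f} (+-comm u v) ⟩
      f + (v + u)      ≈⟨ +-assoc f v u ⟨
      1# - u - v + v + u  ≈⟨ +-congʳ {u} (//-rightDividesˡ v (1# - u)) ⟩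
      1# - u + u       ≈⟨ //-rightDividesˡ u 1# ⟩
      1#               ∎
    f₀≈1 : f 0 R.≈ R.1#
    f₀≈1 = R.trans (R.sym (R.trans
      (R.+-congˡ (R.trans (R.+-cong u₀≈0 v₀≈0) (R.+-identityʳ _))) (R.+-identityʳ _)))
                   (split 0)

  module _ (A : ℕ → ℕ → Carrier) (b w : ℕ → R.Carrier)
           (b≈ : ∀ a → b a R.≈ step a a)
           (w≈ : ∀ a → w a R.≈ step a (suc a) R.* step (suc a) a)
           (A-suc : ∀ a e → A a (suc e) ≡
                      (1# - const (b a) * X - const (w a) * X ^ 2 * A (suc a) e) ⁻¹) where

    -- A path from a back to a that stays at or above a is empty, or starts with a level step, or
    -- starts with a rise, an excursion above a and the matching fall; then another such path
    -- follows.
    A-unfold : ∀ a e → A a (suc e) ≈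
      1# + (const (step a a) * X + const (step a (suc a)) * const (step (suc a) a) * X ^ 2 * A (suc a) e)
           * A a (suc e)
    A-unfold a e = begin
      A a (suc e)                  ≡⟨ A-suc a e ⟩
      (1# - u - v) ⁻¹              ≈⟨ *-inverse-unfold {u} {v} u₀≈0 v₀≈0 ⟩
      1# + (u + v) * (1# - u - v) ⁻¹
        ≈⟨ +-congˡ (*-cong (+-cong (*-congʳ {X} (const-cong (b≈ a)))
                                   (*-congʳ {A (suc a) e} (*-congʳ {X ^ 2} w-split)))
                           (sym (reflexive (A-suc a e)))) ⟩
      1# + (const (step a a) * X + const (step a (suc a)) * const (step (suc a) a) * X ^ 2 * A (suc a) e)
           * A a (suc e) ∎
      where
      u = const (b a) * X
      v = const (w a) * X ^ 2 * A (suc a) e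
      w-split : const (w a) ≈ const (step a (suc a)) * const (step (suc a) a)
      w-split = trans (const-cong (w≈ a)) (const-* (step a (suc a)) (step (suc a) a))
      u₀≈0 : u 0 R.≈ R.0#
      u₀≈0 = R.trans (*-comm (const (b a)) X 0) (X-*-zero (const (b a)))
      v₀≈0 : v 0 R.≈ R.0#
      v₀≈0 = R.trans
        (solve 3 (λ c x y → c :* (x :* (x :* con 1)) :* y := x :* (x :* c :* y)) refl
           (const (w a)) X (A (suc a) e) 0)
        (X-*-zero (X * const (w a) * A (suc a) e))

    -- Cutting a path from height a to height 0 at its first visits to a − 1, …, 0
    -- leaves excursions above a, …, 0, whence this product of convergents; it
    -- counts only the paths that stay below height d.
    mutual
      fromHeight : ℕ → ℕ → Carrier
      fromHeight d a = A a (d ∸ a) * lower d a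

      lower : ℕ → ℕ → Carrier
      lower d zero    = 1#
      lower d (suc a) = X * (const (step (suc a) a) * fromHeight d a)

    fromHeight-unfold : ∀ {d a} → a < d → fromHeight d a ≈
      lower d a + X * (const (step a a) * fromHeight d a
                       + const (step a (suc a)) * fromHeight d (suc a))
    -- As a < d, the convergent at height a has e + 1 levels and unfolds, and the one above it keeps
    -- e of them; hence `C′ * (X * (t * (C * L)))` is `fromHeight d (suc a)`.
    fromHeight-unfold {d} {a} a<d rewrite ℕ.+-∸-assoc 1 a<d = begin
      C * L
        ≈⟨ *-congʳ {L} (A-unfold a e) ⟩
      (1# + (s * X + u * t * X ^ 2 * C′) * C) * L
        ≈⟨ solve 7 (λ s X u t C′ C L →
              (con 1 :+ (s :* X :+ u :* t :* (X :* (X :* con 1)) :* C′) :* C) :* L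
           := L :+ X :* (s :* (C :* L) :+ u :* (C′ :* (X :* (t :* (C :* L))))))
           refl s X u t C′ C L ⟩
      L + X * (s * (C * L) + u * (C′ * (X * (t * (C * L))))) ∎
      where
      e = d ∸ suc a
      C = A a (suc e)
      C′ = A (suc a) e
      L = lower d a
      s = const (step a a)
      u = const (step a (suc a))
      t = const (step (suc a) a)

    -- In n steps a path from a climbs at most to n + a, so below d the truncation of the fraction
    -- is not felt.
    fromHeight-coeff : ∀ {d} n a → n ℕ.+ a < d → fromHeight d a n R.≈ motzkin n a
    fromHeight-coeff {d} zero a a<d = R.trans (fromHeight-unfold a<d 0)
      (R.trans (R.+-cong (lower₀ a) (X-*-zero (const (step a a) * fromHeight d a
                       + const (step a (suc a)) * fromHeight d (suc a)))) (R.+-identityʳ _))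
      where
      lower₀ : ∀ a → lower d a 0 R.≈ motzkin 0 a
      lower₀ zero    = R.refl
      lower₀ (suc a) = X-*-zero (const (step (suc a) a) * fromHeight d a)
    fromHeight-coeff {d} (suc n) a n+a<d = R.trans
      (fromHeight-unfold (ℕ.≤-<-trans (ℕ.m≤n+m a (suc n)) n+a<d) (suc n))
      (R.+-cong (lower-suc a n+a<d) (R.trans
        (X-*-suc (const (step a a) * fromHeight d a + const (step a (suc a)) * fromHeight d (suc a)) n)
        (R.+-cong (scaled (step a a) a (ℕ.<-trans (ℕ.n<1+n _) n+a<d))
                  (scaled (step a (suc a)) (suc a) (≡.subst (_< d) (≡.sym (ℕ.+-suc n a)) n+a<d)))))
      where
      scaled : ∀ x a → n ℕ.+ a < d → (const x * fromHeight d a) n R.≈ x R.* motzkin n a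
      scaled x a n+a<d = R.trans (const-*-coeff x (fromHeight d a) n) (R.*-congˡ (fromHeight-coeff n a n+a<d))
      lower-suc : ∀ a → suc n ℕ.+ a < d → lower d a (suc n) R.≈ descend (motzkin n) a
      lower-suc zero    _     = R.refl
      lower-suc (suc a) n+a<d = R.trans (X-*-suc (const (step (suc a) a) * fromHeight d a) n)
        (scaled (step (suc a) a) a
          (ℕ.<-trans (ℕ.+-monoʳ-< n (ℕ.n<1+n a)) (ℕ.<-trans (ℕ.n<1+n _) n+a<d)))

    continuedFraction-coeff : ∀ {d n} → n < d → A 0 d n R.≈ motzkin n 0
    continuedFraction-coeff {d} {n} n<d = R.trans (R.sym (*-identityʳ (A 0 d) n))
      (fromHeight-coeff n 0 (≡.subst (_< d) (≡.sym (ℕ.+-identityʳ n)) n<d))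

-- Sums over boxes as sums over Motzkin paths

module BoxSums {c ℓ : Level} (R : CommutativeRing c ℓ) where
  open CommutativeRing R
  open import Algebra.Properties.Semiring.Sum semiring using (sum; sum-cong-≋; *-distribˡ-sum)

  -- The counterpart of `sumBox` with values in a ring, where common factors can be pulled out of
  -- the sum.
  boxSum : (B l : ℕ) → (Vec ℕ l → Carrier) → Carrier
  boxSum B zero    F = F []
  boxSum B (suc l) F = sum {suc B} λ a → boxSum B l (λ f → F (toℕ a ∷ f))

  *-distribˡ-boxSum : ∀ B l x F → x * boxSum B l F ≈ boxSum B l (λ f → x * F f)
  *-distribˡ-boxSum B zero    x F = refl
  *-distribˡ-boxSum B (suc l) x F = trans
    (*-distribˡ-sum {suc B} x (λ a → boxSum B l (λ f → F (toℕ a ∷ f))))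
    (sum-cong-≋ {suc B} λ a → *-distribˡ-boxSum B l x (λ f → F (toℕ a ∷ f)))

module MotzkinPathSums {c ℓ : Level} (R : CommutativeRing c ℓ)
    (step : ℕ → ℕ → CommutativeRing.Carrier R)
    (rise>1 : ∀ {a b} → suc a < b → CommutativeRing._≈_ R (step a b) (CommutativeRing.0# R))
    (fall>1 : ∀ {a b} → suc b < a → CommutativeRing._≈_ R (step a b) (CommutativeRing.0# R)) where
  open CommutativeRing R
  open MonoidSums +-monoid
  open MotzkinPaths R step using (descend; motzkin)
  open BoxSums R
  open import Algebra.Properties.Semiring.Sum semiring using (sum; sum-cong-≋)
  open import Relation.Binary.Reasoning.Setoid setoid

  -- The entries are the heights after the starting height a. The empty vector still pays for the
  -- closing step to 0, so l entries make l + 1 steps, matching f_n = 0 for n = l + 1.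
  pathWeight : ∀ {l} → ℕ → Vec ℕ l → Carrier
  pathWeight a []      = step a 0
  pathWeight a (b ∷ f) = step a b * pathWeight b f

  *-zero : ∀ {x y} → x ≈ 0# → x * y ≈ 0#
  *-zero {x} {y} x≈0 = trans (*-congʳ x≈0) (zeroˡ y)

  sum-descend : ∀ a (m : ℕ → Carrier) → sum {a} (λ i → step a (toℕ i) * m (toℕ i)) ≈ descend m a
  sum-descend zero    m = refl
  sum-descend (suc a) m = trans (sum-snoc a v)
    (trans (+-congʳ (sum-zero a v λ k k<a → *-zero (fall>1 (s≤s k<a)))) (+-identityˡ _))
    where
    v : ℕ → Carrier
    v b = step (suc a) b * m b

  -- Only the heights a - 1, a and a + 1 survive: `rise>1` cuts the sum above, `fall>1` below. The
  -- bound on B keeps a + 1 inside the box.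
  sum-step : ∀ {B} a (m : ℕ → Carrier) → suc a ≤ B →
    sum {suc B} (λ i → step a (toℕ i) * m (toℕ i)) ≈
    descend m a + (step a a * m a + step a (suc a) * m (suc a))
  sum-step {B} a m a<B = begin
    sum {suc B} (v ∘ toℕ)
      ≈⟨ sum-extend (s≤s a<B) v (λ k 1+a<k → *-zero (rise>1 1+a<k)) ⟩
    sum {suc (suc a)} (v ∘ toℕ)
      ≈⟨ sum-snoc (suc a) v ⟩
    sum {suc a} (v ∘ toℕ) + v (suc a)
      ≈⟨ +-congʳ (sum-snoc a v) ⟩
    sum {a} (v ∘ toℕ) + v a + v (suc a)
      ≈⟨ +-assoc _ _ _ ⟩
    sum {a} (v ∘ toℕ) + (v a + v (suc a))
      ≈⟨ +-congʳ (sum-descend a m) ⟩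
    descend m a + (v a + v (suc a)) ∎
    where
    v : ℕ → Carrier
    v b = step a b * m b

  motzkin-1 : ∀ a → step a 0 ≈ motzkin 1 a
  motzkin-1 zero          = sym (trans (+-identityˡ _) (trans (+-cong (*-identityʳ _) (zeroʳ _)) (+-identityʳ _)))
  motzkin-1 (suc zero)    = sym (trans (+-cong (*-identityʳ _)
    (trans (+-cong (zeroʳ _) (zeroʳ _)) (+-identityʳ _))) (+-identityʳ _))
  motzkin-1 (suc (suc a)) = trans (fall>1 (s≤s (s≤s z≤n))) (sym (trans (+-cong (zeroʳ _)
    (trans (+-cong (zeroʳ _) (zeroʳ _)) (+-identityʳ _))) (+-identityʳ _)))

  -- Along a path of nonzero weight the entries are at most a + 1, ..., a + l, so the box omits no
  -- such path.
  boxSum-pathWeight : ∀ {B} l a → a ℕ.+ l ≤ B → boxSum B l (pathWeight a) ≈ motzkin (suc l) a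
  boxSum-pathWeight {B} zero    a _     = motzkin-1 a
  boxSum-pathWeight {B} (suc l) a a+l≤B = trans
    (sum-cong-≋ {suc B} λ i → inner (toℕ i))
    (sum-step a (motzkin (suc l)) (ℕ.≤-trans (ℕ.m≤m+n (suc a) l) 1+a+l≤B))
    where
    1+a+l≤B : suc a ℕ.+ l ≤ B
    1+a+l≤B = ≡.subst (_≤ B) (ℕ.+-suc a l) a+l≤B
    inner : ∀ b → boxSum B l (λ f → step a b * pathWeight b f) ≈ step a b * motzkin (suc l) b
    inner b = trans (sym (*-distribˡ-boxSum B l (step a b) (pathWeight b))) compare
      where
      compare : step a b * boxSum B l (pathWeight b) ≈ step a b * motzkin (suc l) b
      -- The induction hypothesis needs b + l ≤ B, which is secured for b ≤ a + 1; for larger b the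
      -- step weight annihilates both sides.
      compare with b ℕ.≤? suc a
      ... | yes b≤1+a = *-congˡ (boxSum-pathWeight l b (ℕ.≤-trans (ℕ.+-monoˡ-≤ l b≤1+a) 1+a+l≤B))
      ... | no  b≰1+a = trans (*-zero step≈0) (sym (*-zero step≈0))
        where step≈0 = rise>1 (ℕ.≰⇒> b≰1+a)

-- Power series as two-sided sequences

open ≡ using (refl; sym; trans; cong; cong₂; subst)
open Series ℤ.+-*-commutativeRing renaming (seriesRing to ℤ[[q]])
open GaussianBinomials ℤ.+-*-commutativeRing
open BoxSums ℤ[[q]]
open Q using (const; X; _^_; _-_; product)
private module Qr = CommutativeRing ℤ[[q]]
open Qr using (_≈_; _+_; _*_; 0#; 1#) renaming (Carrier to Series)
open import Algebra.Properties.Semiring.Sum Qr.semiring using (sum)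
open import Algebra.Properties.Semiring.Sum (CommutativeRing.semiring ℤ.+-*-commutativeRing)
  using () renaming (sum to ℤ-sum; sum-cong-≗ to ℤ-sum-cong)

ι-cong : ∀ {f g} → f ≈ g → ι f ≋ ι g
ι-cong f≈g (+ n)    = f≈g n
ι-cong f≈g -[1+ n ] = refl

ι-+ : ∀ f g j → ι (f + g) j ≡ ι f j ℤ.+ ι g j
ι-+ f g (+ n)    = refl
ι-+ f g -[1+ n ] = refl

ι-neg : ∀ f j → ι (Qr.- f) j ≡ ℤ.- ι f j
ι-neg f (+ n)    = refl
ι-neg f -[1+ n ] = refl

ι-zero : ∀ {f} → f ≈ 0# → ∀ j → ι f j ≡ ℤ.0ℤ
ι-zero f≈0 (+ n)    = f≈0 n
ι-zero f≈0 -[1+ n ] = refl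

ι-const-* : ∀ a f j → ι (const a * f) j ≡ a ℤ.* ι f j
ι-const-* a f (+ n)    = const-*-coeff a f n
ι-const-* a f -[1+ n ] = sym (ℤ.*-zeroʳ a)

ι-const-even : ∀ a j → ι (const a) (ℤ.- j) ≡ ι (const a) j
ι-const-even a (+ zero)  = refl
ι-const-even a (+ suc n) = refl
ι-const-even a -[1+ n ]  = refl

ι-X-* : ∀ f j → ι (X * f) j ≡ ι f (j ℤ.- ℤ.1ℤ)
ι-X-* f (+ zero)  = X-*-zero f
ι-X-* f (+ suc n) = X-*-suc f n
ι-X-* f -[1+ n ]  = refl

ι-X^-* : ∀ n f j → ι (X ^ n * f) j ≡ ι f (j ℤ.- + n)
ι-X^-* zero    f j = trans (ι-cong (Qr.*-identityˡ f) j) (cong (ι f) (sym (ℤ.+-identityʳ j)))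
ι-X^-* (suc n) f j = begin
  ι (X * X ^ n * f) j             ≡⟨ ι-cong (Qr.*-assoc X (X ^ n) f) j ⟩
  ι (X * (X ^ n * f)) j           ≡⟨ ι-X-* (X ^ n * f) j ⟩
  ι (X ^ n * f) (j ℤ.- ℤ.1ℤ)      ≡⟨ ι-X^-* n f (j ℤ.- ℤ.1ℤ) ⟩
  ι f (j ℤ.- ℤ.1ℤ ℤ.- + n)        ≡⟨ cong (ι f) (shift j (+ n)) ⟩
  ι f (j ℤ.- + suc n)             ∎
  where
  open ≡.≡-Reasoning
  shift : ∀ j n → j ℤ.- ℤ.1ℤ ℤ.- n ≡ j ℤ.- (ℤ.1ℤ ℤ.+ n)
  shift = solve-∀

-- Reversal of polynomials

-- g = q^d f(q⁻¹)
record Reciprocal (d : ℤ) (f g : Series) : Set where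
  field reflect : ∀ j → ι g j ≡ ι f (d ℤ.- j)

open Reciprocal

module _ where
  open ≡.≡-Reasoning

  reciprocal-cong : ∀ {d f f′ g g′} → f ≈ f′ → g ≈ g′ → Reciprocal d f g → Reciprocal d f′ g′
  reciprocal-cong {d} f≈ g≈ r .reflect j =
    trans (sym (ι-cong g≈ j)) (trans (r .reflect j) (ι-cong f≈ (d ℤ.- j)))

  d-[d-j]≡j : ∀ d j → d ℤ.- (d ℤ.- j) ≡ j
  d-[d-j]≡j = solve-∀

  reciprocal-sym : ∀ {d f g} → Reciprocal d f g → Reciprocal d g f
  reciprocal-sym {d} {f} r .reflect j = sym (trans (r .reflect (d ℤ.- j)) (cong (ι f) (d-[d-j]≡j d j)))

  reciprocal-+ : ∀ {d f f′ g g′} → Reciprocal d f g → Reciprocal d f′ g′ → Reciprocal d (f + f′) (g + g′)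
  reciprocal-+ {d} {f} {f′} {g} {g′} r r′ .reflect j = begin
    ι (g + g′) j                        ≡⟨ ι-+ g g′ j ⟩
    ι g j ℤ.+ ι g′ j                    ≡⟨ cong₂ ℤ._+_ (r .reflect j) (r′ .reflect j) ⟩
    ι f (d ℤ.- j) ℤ.+ ι f′ (d ℤ.- j)    ≡⟨ ι-+ f f′ (d ℤ.- j) ⟨
    ι (f + f′) (d ℤ.- j)                ∎

  reciprocal-const : ∀ a → Reciprocal ℤ.0ℤ (const a) (const a)
  reciprocal-const a .reflect j =
    trans (sym (ι-const-even a j)) (cong (ι (const a)) (sym (ℤ.+-identityˡ (ℤ.- j))))

  reciprocal-const-* : ∀ {d f g} a → Reciprocal d f g → Reciprocal d (const a * f) (const a * g)
  reciprocal-const-* {d} {f} {g} a r .reflect j = begin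
    ι (const a * g) j            ≡⟨ ι-const-* a g j ⟩
    a ℤ.* ι g j                  ≡⟨ cong (a ℤ.*_) (r .reflect j) ⟩
    a ℤ.* ι f (d ℤ.- j)          ≡⟨ ι-const-* a f (d ℤ.- j) ⟨
    ι (const a * f) (d ℤ.- j)    ∎

  reciprocal-X^-*ʳ : ∀ {d f g} n → Reciprocal d f g → Reciprocal (+ n ℤ.+ d) f (X ^ n * g)
  reciprocal-X^-*ʳ {d} {f} {g} n r .reflect j = begin
    ι (X ^ n * g) j              ≡⟨ ι-X^-* n g j ⟩
    ι g (j ℤ.- + n)              ≡⟨ r .reflect (j ℤ.- + n) ⟩
    ι f (d ℤ.- (j ℤ.- + n))      ≡⟨ cong (ι f) (shift d j (+ n)) ⟩
    ι f (+ n ℤ.+ d ℤ.- j)        ∎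
    where
    shift : ∀ d j n → d ℤ.- (j ℤ.- n) ≡ n ℤ.+ d ℤ.- j
    shift = solve-∀

  reciprocal-X^-*ˡ : ∀ {d f g} n → Reciprocal d f g → Reciprocal (+ n ℤ.+ d) (X ^ n * f) g
  reciprocal-X^-*ˡ n r = reciprocal-sym (reciprocal-X^-*ʳ n (reciprocal-sym r))

  reciprocal-X-*ˡ : ∀ {d f g} → Reciprocal d f g → Reciprocal (ℤ.1ℤ ℤ.+ d) (X * f) g
  reciprocal-X-*ˡ {f = f} r =
    reciprocal-cong (Qr.*-congʳ {f} (Qr.*-identityʳ X)) Qr.refl (reciprocal-X^-*ˡ 1 r)

  -- For d < 0 and j ≥ 0 the index d - j is negative, where `ι f` is zero.
  negative-degree : ∀ {n f g} → Reciprocal -[1+ n ] f g → g ≈ 0#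
  negative-degree r zero    = r .reflect (+ 0)
  negative-degree r (suc i) = r .reflect (+ suc i)

  -- Splits off the constant term of f, which is the leading term of g.
  reciprocal-*-ℕ : ∀ n {e f g h k} → Reciprocal (+ n) f g → Reciprocal e h k →
                   Reciprocal (+ n ℤ.+ e) (f * h) (g * k)
  reciprocal-*-ℕ zero {e} {f} {g} {h} {k} r s =
    subst (λ d → Reciprocal d (f * h) (g * k)) (sym (ℤ.+-identityˡ e))
      (reciprocal-cong
        (Qr.*-congʳ {h} (Qr.sym f-const)) (Qr.*-congʳ {k} (Qr.sym g-const))
        (reciprocal-const-* (f 0) s))
    where
    f-const : f ≈ const (f 0)
    f-const zero    = refl
    f-const (suc i) = reciprocal-sym r .reflect (+ suc i)
    g-const : g ≈ const (f 0)
    g-const zero    = r .reflect (+ 0)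
    g-const (suc i) = r .reflect (+ suc i)
  reciprocal-*-ℕ (suc n) {e} {f} {g} {h} {k} r s =
    reciprocal-cong f-split g-split (reciprocal-+ lead rest)
    where
    c = const (f 0)
    t = tail f
    m = X ^ suc n
    g′ = g - m * c
    ch = c * h
    Xth = X * (t * h)
    Xck = m * (c * k)
    g′k = g′ * k
    f-split : ch + Xth ≈ f * h
    f-split = Qr.trans (Qr.+-congˡ {ch} (Qr.sym (Qr.*-assoc X t h)))
      (Qr.trans (Qr.sym (Qr.distribʳ h c (X * t))) (Qr.*-congʳ {h} (Qr.sym (const-+-X-*-tail f))))
    cancel : m * c + g′ ≈ g
    cancel i = ring (g i) ((m * c) i)
      where
      ring : ∀ x y → y ℤ.+ (x ℤ.- y) ≡ x
      ring = solve-∀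
    g-split : Xck + g′k ≈ g * k
    g-split = Qr.trans (Qr.+-congʳ {g′k} (Qr.sym (Qr.*-assoc m c k)))
      (Qr.trans (Qr.sym (Qr.distribʳ k (m * c) g′)) (Qr.*-congʳ {k} cancel))
    lead : Reciprocal (+ suc n ℤ.+ e) ch Xck
    lead = reciprocal-X^-*ʳ (suc n) (reciprocal-const-* (f 0) s)
    -- Removing the constant term of f and the leading term of g leaves `X * t` opposite `g′`;
    -- dividing out X lowers the degree to n, so the induction applies.
    t∼g′ : Reciprocal (+ n) t g′
    t∼g′ .reflect j = begin
      ι (g - m * c) j
        ≡⟨ trans (ι-+ g (Qr.- (m * c)) j) (cong (λ x → ι g j ℤ.+ x) (ι-neg (m * c) j)) ⟩
      ι g j ℤ.- ι (m * c) j
        ≡⟨ cong₂ ℤ._-_ (r .reflect j) (reciprocal-X^-*ʳ (suc n) (reciprocal-const (f 0)) .reflect j) ⟩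
      ι f d ℤ.- ι c (+ (suc n ℕ.+ 0) ℤ.- j)
        ≡⟨ cong₂ ℤ._-_ (trans (ι-cong (const-+-X-*-tail f) d) (ι-+ c (X * t) d))
             (cong (λ n → ι c (+ n ℤ.- j)) (ℕ.+-identityʳ (suc n))) ⟩
      (ι c d ℤ.+ ι (X * t) d) ℤ.- ι c d
        ≡⟨ ring (ι c d) (ι (X * t) d) ⟩
      ι (X * t) d
        ≡⟨ ι-X-* t d ⟩
      ι t (d ℤ.- ℤ.1ℤ)
        ≡⟨ cong (ι t) (shift (+ n) j) ⟩
      ι t (+ n ℤ.- j) ∎
      where
      d = + suc n ℤ.- j
      ring : ∀ x y → x ℤ.+ y ℤ.- x ≡ y
      ring = solve-∀
      shift : ∀ n j → ℤ.1ℤ ℤ.+ n ℤ.- j ℤ.- ℤ.1ℤ ≡ n ℤ.- j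
      shift = solve-∀
    rest : Reciprocal (+ suc n ℤ.+ e) Xth g′k
    rest = subst (λ d → Reciprocal d Xth g′k) (sym (ℤ.+-assoc ℤ.1ℤ (+ n) e))
      (reciprocal-X-*ˡ (reciprocal-*-ℕ n t∼g′ s))

  -- A negative degree forces both members of the first pair to be zero, so the induction over
  -- natural degrees covers the rest.
  reciprocal-* : ∀ {d e f g h k} → Reciprocal d f g → Reciprocal e h k →
                 Reciprocal (d ℤ.+ e) (f * h) (g * k)
  reciprocal-* {+ n} r s = reciprocal-*-ℕ n r s
  reciprocal-* { -[1+ n ]} {e} {f} {g} {h} {k} r s .reflect j = trans
    (vanish g k (negative-degree r) j)
    (sym (vanish f h (negative-degree (reciprocal-sym r)) (-[1+ n ] ℤ.+ e ℤ.- j)))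
    where
    vanish : ∀ x y → x ≈ 0# → ∀ j → ι (x * y) j ≡ ℤ.0ℤ
    vanish x y x≈0 = ι-zero (Qr.trans (Qr.*-congʳ {y} x≈0) (Qr.zeroˡ y))

-- The indices are swapped on the right because reversal exchanges the two terms of the q-Pascal
-- rule: the reversed sum is then exactly the defining recursion of `gauss (suc j) (suc k)`.
gauss-reciprocal : ∀ k j → Reciprocal (+ (k ℕ.* j)) (gauss k j) (gauss j k)
gauss-reciprocal zero    j       =
  reciprocal-cong const-1 (Qr.trans const-1 (Qr.sym (gauss-zeroʳ j))) (reciprocal-const ℤ.1ℤ)
  where
  const-1 : const ℤ.1ℤ ≈ 1#
  const-1 zero    = refl
  const-1 (suc _) = refl
gauss-reciprocal (suc k) zero    =
  subst (λ n → Reciprocal (+ n) 1# 1#) (sym (ℕ.*-zeroʳ k)) (gauss-reciprocal 0 0)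
gauss-reciprocal (suc k) (suc j) =
  reciprocal-cong Qr.refl (Qr.+-comm (X ^ suc j * gauss (suc j) k) (gauss j (suc k)))
    (reciprocal-+
      (reciprocal-X^-*ʳ (suc j) (gauss-reciprocal k (suc j)))
      (subst (λ n → Reciprocal (+ n) (X ^ suc k * gauss (suc k) j) (gauss j (suc k)))
        (sym (ℕ.*-suc (suc k) j))
        (reciprocal-X^-*ˡ (suc k) (gauss-reciprocal (suc k) j))))

gauss-palindromic : ∀ k j {f} → f ≈ gauss k j → Reciprocal (+ k ℤ.* + j) f f
gauss-palindromic k j {f} f≈ = subst (λ d → Reciprocal d f f) (ℤ.pos-* k j)
  (reciprocal-cong (Qr.sym f≈) (Qr.trans (gauss-sym j k) (Qr.sym f≈)) (gauss-reciprocal k j))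

zero-palindromic : ∀ {d f} → f ≈ 0# → Reciprocal d f f
zero-palindromic {d} f≈0 .reflect j = trans (ι-zero f≈0 j) (sym (ι-zero f≈0 (d ℤ.- j)))

binom≡gaussBinom : ∀ m k → binom m k ≡ gaussBinom m k
binom≡gaussBinom m k = cong (if k ≤ᵇ m then_else 0#)
  (cong₂ Q._÷_ ([]!≡qfact m) (cong₂ Q._*_ ([]!≡qfact k) ([]!≡qfact (m ∸ k))))
  where
  []!≡qfact : ∀ m → [ m ]! ≡ qfact m
  []!≡qfact m = refl

binom-gauss : ∀ k j → binom (k ℕ.+ j) k ≈ gauss k j
binom-gauss k j = subst (_≈ gauss k j) (sym (binom≡gaussBinom (k ℕ.+ j) k)) (gaussBinom-gauss k j)

binom-zero : ∀ {m k} → m < k → binom m k ≈ 0#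
binom-zero {m} {k} m<k = subst (_≈ 0#) (sym (binom≡gaussBinom m k)) (gaussBinom-zero m<k)

ι-sum : ∀ {n} (v : Fin n → Series) j → ι (sum v) j ≡ ℤ-sum λ i → ι (v i) j
ι-sum {zero}  v j = ι-zero Qr.refl j
ι-sum {suc n} v j = trans (ι-+ (v Fin.zero) (sum λ i → v (Fin.suc i)) j)
  (cong (ℤ._+_ (ι (v Fin.zero) j)) (ι-sum (λ i → v (Fin.suc i)) j))

-- The separate indices i and j let the reversal of q be carried out summand by summand.
sumBox-ι : ∀ B l {F : Vec ℕ l → TwoSided} {G : Vec ℕ l → Series} {i j} →
           (∀ f → F f i ≡ ι (G f) j) → sumBox B l F i ≡ ι (boxSum B l G) j
sumBox-ι B zero    eq = eq []
sumBox-ι B (suc l) {F} {G} {i} {j} eq = trans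
  (ℤ-sum-cong {suc B} λ a → sumBox-ι B l {λ f → F (toℕ a ∷ f)} {λ f → G (toℕ a ∷ f)} {i} {j}
    λ f → eq (toℕ a ∷ f))
  (sym (ι-sum {suc B} (λ a → boxSum B l (λ f → G (toℕ a ∷ f))) j))

-- Exponents and weights of paths

-- Degree of the first product of binomials, with a in the role of f_0; each factor of m over k
-- contributes k(m - k).
firstDegree : ∀ {l} → ℕ → Vec ℕ l → ℤ
firstDegree a []      = ℤ.0ℤ
firstDegree a (b ∷ f) = + b ℤ.* (+ suc a ℤ.- + b) ℤ.+ firstDegree b f

secondDegree : ∀ {l} → Vec ℕ l → ℤ
secondDegree []      = ℤ.0ℤ
secondDegree (b ∷ f) = + b ℤ.* (+ suc (entry f 1) ℤ.- + b) ℤ.+ secondDegree f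

exponentFrom : ∀ {l} → ℕ → Vec ℕ l → ℤ
exponentFrom c []      = ℤ.0ℤ
exponentFrom c (b ∷ f) =
  (+ suc c ℤ.- + b) ℤ.* (ℤ.1ℤ ℤ.- + b ℤ.+ + entry f 1) ℤ.+ exponentFrom (suc c) f

energy : ∀ {l} → ℕ → Vec ℕ l → ℤ
energy a []      = ℤ.0ℤ
energy a (b ∷ f) = + b ℤ.* (+ b ℤ.- + a) ℤ.+ energy b f

-- The closing step to 0 is never a rise; `0 ∸ a` is kept to match the power of X in the weight of
-- that step.
rises : ∀ {l} → ℕ → Vec ℕ l → ℕ
rises a []      = 0 ∸ a
rises a (b ∷ f) = (b ∸ a) ℕ.+ rises b f

consecutiveSum : ℕ → ℕ → ℕ
consecutiveSum c zero    = 0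
consecutiveSum c (suc l) = suc c ℕ.+ consecutiveSum (suc c) l

exponent-from : ∀ {l} c (f : Vec ℕ l) →
  ℤ-sum {l} (λ i → (+ suc (c ℕ.+ toℕ i) ℤ.- + entry f (suc (toℕ i)))
    ℤ.* (ℤ.1ℤ ℤ.- + entry f (suc (toℕ i)) ℤ.+ + entry f (suc (suc (toℕ i)))))
  ≡ exponentFrom c f
exponent-from c []              = refl
exponent-from {suc l} c (b ∷ f) = cong₂ ℤ._+_
  (cong (λ k → (+ suc k ℤ.- + b) ℤ.* (ℤ.1ℤ ℤ.- + b ℤ.+ + entry f 1)) (ℕ.+-identityʳ c))
  (trans (ℤ-sum-cong {l} λ i → cong (λ k → (+ suc k ℤ.- + entry f (suc (toℕ i)))
           ℤ.* (ℤ.1ℤ ℤ.- + entry f (suc (toℕ i)) ℤ.+ + entry f (suc (suc (toℕ i))))) (ℕ.+-suc c (toℕ i)))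
         (exponent-from (suc c) f))

-- For c = 0: n(n−1)/2 minus the CFR exponent minus the degree of the weight is
-- Σ f_k (f_k − f_{k−1}), the exponent of q left after q ↦ q⁻¹.
degree-balance : ∀ {l} c a (f : Vec ℕ l) →
  exponentFrom c f ℤ.+ (firstDegree a f ℤ.+ secondDegree f) ℤ.+ energy a f ℤ.+ + c ℤ.* + entry f 1
  ≡ + consecutiveSum c l
degree-balance c a []              = trans (ℤ.+-identityˡ _) (ℤ.*-zeroʳ (+ c))
degree-balance {suc l} c a (b ∷ f) = trans
  -- For each entry the quadratic terms cancel, leaving c + 1 and (c + 1)b′ - cb. The correction
  -- `c * entry f 1` makes the latter telescope and disappears at c = 0.
  (ring (+ c) (+ a) (+ b) (+ entry f 1) (exponentFrom (suc c) f) (firstDegree b f) (secondDegree f) (energy b f))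
  (cong (ℤ._+_ (+ suc c)) (degree-balance (suc c) b f))
  where
  ring : ∀ c a b b′ E D₁ D₂ V →
    ((ℤ.1ℤ ℤ.+ c ℤ.- b) ℤ.* (ℤ.1ℤ ℤ.- b ℤ.+ b′) ℤ.+ E)
      ℤ.+ ((b ℤ.* (ℤ.1ℤ ℤ.+ a ℤ.- b) ℤ.+ D₁) ℤ.+ (b ℤ.* (ℤ.1ℤ ℤ.+ b′ ℤ.- b) ℤ.+ D₂))
      ℤ.+ (b ℤ.* (b ℤ.- a) ℤ.+ V) ℤ.+ c ℤ.* b
    ≡ (ℤ.1ℤ ℤ.+ c) ℤ.+ (E ℤ.+ (D₁ ℤ.+ D₂) ℤ.+ V ℤ.+ (ℤ.1ℤ ℤ.+ c) ℤ.* b′)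
  ring = solve-∀

consecutiveSum-*2 : ∀ c l → consecutiveSum c l ℕ.* 2 ≡ l ℕ.* (c ℕ.+ c ℕ.+ suc l)
consecutiveSum-*2 c zero    = refl
consecutiveSum-*2 c (suc l) = begin
  (suc c ℕ.+ consecutiveSum (suc c) l) ℕ.* 2
    ≡⟨ ℕ.*-distribʳ-+ 2 (suc c) (consecutiveSum (suc c) l) ⟩
  suc c ℕ.* 2 ℕ.+ consecutiveSum (suc c) l ℕ.* 2
    ≡⟨ cong (suc c ℕ.* 2 ℕ.+_) (consecutiveSum-*2 (suc c) l) ⟩
  suc c ℕ.* 2 ℕ.+ l ℕ.* (suc c ℕ.+ suc c ℕ.+ suc l)
    ≡⟨ ring c l ⟩
  suc l ℕ.* (c ℕ.+ c ℕ.+ suc (suc l)) ∎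
  where
  open ≡.≡-Reasoning
  ring : ∀ c l → (1 ℕ.+ c) ℕ.* 2 ℕ.+ l ℕ.* (1 ℕ.+ c ℕ.+ (1 ℕ.+ c) ℕ.+ (1 ℕ.+ l))
               ≡ (1 ℕ.+ l) ℕ.* (c ℕ.+ c ℕ.+ (2 ℕ.+ l))
  ring = ℕ-Solver.solve-∀

n[n-1]/2 : ∀ n → n ℕ.* (n ∸ 1) / 2 ≡ consecutiveSum 0 (n ∸ 1)
n[n-1]/2 zero    = refl
n[n-1]/2 (suc l) = trans
  (cong (_/ 2) (trans (ℕ.*-comm (suc l) l) (sym (consecutiveSum-*2 0 l))))
  (m*n/n≡m (consecutiveSum 0 l) 2)

-- The potential by which f_k (f_k − f_{k−1}) differs from the indicator of a rise.
triangular : ℕ → ℤ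
triangular zero    = ℤ.0ℤ
triangular (suc a) = + a ℤ.+ triangular a

-- The binomials enter through these two facts alone, so their definition by division stays out of
-- the path argument.
module Weights (β : ℕ → ℕ → Series)
               (β-gauss : ∀ k j → β (k ℕ.+ j) k ≈ gauss k j)
               (β-zero : ∀ {m k} → m < k → β m k ≈ 0#) where
  open import Algebra.Solver.Ring.NaturalCoefficients.Default Qr.commutativeSemiring
    using (solve; _:=_; _:+_; _:*_; con)
  open import Algebra.Properties.CommutativeSemigroup Qr.*-commutativeSemigroup using (interchange)
  open import Relation.Binary.Reasoning.Setoid Qr.setoid

  -- For k > m the stated degree is negative, which is harmless: the zero series is its own reversal
  -- in every degree.
  β-palindromic : ∀ m k → Reciprocal (+ k ℤ.* (+ m ℤ.- + k)) (β m k) (β m k)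
  β-palindromic m k = [ (λ m<k → zero-palindromic (β-zero m<k)) , nonzero ]′ (ℕ.<-≤-connex m k)
    where
    nonzero : k ≤ m → Reciprocal (+ k ℤ.* (+ m ℤ.- + k)) (β m k) (β m k)
    nonzero k≤m = subst (λ d → Reciprocal d (β m k) (β m k))
      (cong (+ k ℤ.*_) (trans (sym (ℤ.⊖-≥ k≤m)) (sym (ℤ.m-n≡m⊖n m k))))
      (gauss-palindromic k (m ∸ k)
        (subst (λ n → β n k ≈ gauss k (m ∸ k)) (ℕ.m+[n∸m]≡n k≤m) (β-gauss k (m ∸ k))))

  β-0 : ∀ m → β m 0 ≈ 1#
  β-0 m = β-gauss 0 m

  β-self : ∀ m → β m m ≈ 1#
  β-self m = Qr.trans (subst (λ n → β n m ≈ gauss m 0) (ℕ.+-identityʳ m) (β-gauss m 0)) (gauss-zeroʳ m)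

  β-sym : ∀ k j → β (j ℕ.+ k) k ≈ β (k ℕ.+ j) j
  β-sym k j = Qr.trans (subst (λ n → β n k ≈ gauss k j) (ℕ.+-comm k j) (β-gauss k j))
    (Qr.trans (gauss-sym k j) (Qr.sym (subst (λ n → β n j ≈ gauss j k) (ℕ.+-comm j k) (β-gauss j k))))

  firstProduct : ∀ {l} → ℕ → Vec ℕ l → Series
  firstProduct a []      = 1#
  firstProduct a (b ∷ f) = β (suc a) b * firstProduct b f

  secondProduct : ∀ {l} → Vec ℕ l → Series
  secondProduct []      = 1#
  secondProduct (b ∷ f) = β (suc (entry f 1)) b * secondProduct f

  weightOf : ∀ {l} → Vec ℕ l → Series
  weightOf {l} f = product {l} (λ i → β (1 ℕ.+ entry f (toℕ i)) (entry f (suc (toℕ i))))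
                 * product {l} (λ i → β (1 ℕ.+ entry f (suc (suc (toℕ i)))) (entry f (suc (toℕ i))))

  -- Prepending a supplies the height before the first entry; `entry f 0` is always 0 and would not
  -- survive the induction.
  product-first : ∀ {l} a (f : Vec ℕ l) →
    product {l} (λ i → β (1 ℕ.+ entry (a ∷ f) (suc (toℕ i))) (entry f (suc (toℕ i)))) ≈ firstProduct a f
  product-first a []      = Qr.refl
  product-first a (b ∷ f) = Qr.*-congˡ {β (suc a) b} (product-first b f)

  product-first₀ : ∀ {l} (f : Vec ℕ l) →
    product {l} (λ i → β (1 ℕ.+ entry f (toℕ i)) (entry f (suc (toℕ i)))) ≈ firstProduct 0 f
  product-first₀ []      = Qr.refl
  product-first₀ (b ∷ f) = Qr.*-congˡ {β 1 b} (product-first b f)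

  product-second : ∀ {l} (f : Vec ℕ l) →
    product {l} (λ i → β (1 ℕ.+ entry f (suc (suc (toℕ i)))) (entry f (suc (toℕ i)))) ≈ secondProduct f
  product-second []      = Qr.refl
  product-second (b ∷ f) = Qr.*-congˡ {β (suc (entry f 1)) b} (product-second f)

  secondProduct-0∷ : ∀ {l} (f : Vec ℕ l) → secondProduct (0 ∷ f) ≈ secondProduct f
  secondProduct-0∷ f =
    Qr.trans (Qr.*-congʳ {secondProduct f} (β-0 (suc (entry f 1)))) (Qr.*-identityˡ (secondProduct f))

  1-palindromic : Reciprocal ℤ.0ℤ 1# 1#
  1-palindromic = gauss-reciprocal 0 0

  firstProduct-palindromic : ∀ {l} a (f : Vec ℕ l) →
    Reciprocal (firstDegree a f) (firstProduct a f) (firstProduct a f)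
  firstProduct-palindromic a []      = 1-palindromic
  firstProduct-palindromic a (b ∷ f) =
    reciprocal-* (β-palindromic (suc a) b) (firstProduct-palindromic b f)

  secondProduct-palindromic : ∀ {l} (f : Vec ℕ l) →
    Reciprocal (secondDegree f) (secondProduct f) (secondProduct f)
  secondProduct-palindromic []      = 1-palindromic
  secondProduct-palindromic (b ∷ f) =
    reciprocal-* (β-palindromic (suc (entry f 1)) b) (secondProduct-palindromic f)

  -- With a = f_{k-1} and b = f_k, one binomial is the factor of index k in the first product, the
  -- other that of index k - 1 in the second. The power of X marks a rise.
  step : ℕ → ℕ → Series
  step a b = X ^ (b ∸ a) * (β (suc a) b * β (suc b) a)

  zero-* : ∀ {x} y → x ≈ 0# → x * y ≈ 0#
  zero-* y x≈0 = Qr.trans (Qr.*-congʳ {y} x≈0) (Qr.zeroˡ y)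

  *-zero : ∀ x {y} → y ≈ 0# → x * y ≈ 0#
  *-zero x y≈0 = Qr.trans (Qr.*-congˡ {x} y≈0) (Qr.zeroʳ x)

  rise>1 : ∀ {a b} → suc a < b → step a b ≈ 0#
  rise>1 {a} {b} 1+a<b = *-zero (X ^ (b ∸ a)) (zero-* (β (suc b) a) (β-zero 1+a<b))

  fall>1 : ∀ {a b} → suc b < a → step a b ≈ 0#
  fall>1 {a} {b} 1+b<a = *-zero (X ^ (b ∸ a)) (*-zero (β (suc a) b) (β-zero 1+b<a))

  open MotzkinPaths ℤ[[q]] step using (motzkin) public
  open MotzkinPathSums ℤ[[q]] step rise>1 fall>1 using (pathWeight; boxSum-pathWeight) public
  open import Algebra.Properties.Semiring.Exp Qr.semiring using (^-homo-*)

  -- Each step takes its second binomial from the height it leaves, hence the second product over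
  -- `a ∷ f`. For a = 0 the extra factor is 1.
  pathWeight-products : ∀ {l} a (f : Vec ℕ l) →
    pathWeight a f ≈ X ^ rises a f * (firstProduct a f * secondProduct (a ∷ f))
  pathWeight-products a []      = Qr.*-congˡ {X ^ (0 ∸ a)}
    (Qr.*-cong (β-0 (suc a)) (Qr.sym (Qr.*-identityʳ (β 1 a))))
  pathWeight-products a (b ∷ f) = begin
    x * (u * v) * pathWeight b f
      ≈⟨ Qr.*-congˡ {x * (u * v)} (pathWeight-products b f) ⟩
    x * (u * v) * (y * (P * S))
      ≈⟨ interchange x (u * v) y (P * S) ⟩
    x * y * (u * v * (P * S))
      ≈⟨ Qr.*-congˡ {x * y} (interchange u v P S) ⟩
    x * y * (u * P * (v * S))
      ≈⟨ Qr.*-congʳ {u * P * (v * S)} (^-homo-* X (b ∸ a) (rises b f)) ⟨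
    X ^ rises a (b ∷ f) * (u * P * (v * S)) ∎
    where
    x = X ^ (b ∸ a)
    u = β (suc a) b
    v = β (suc b) a
    y = X ^ rises b f
    P = firstProduct b f
    S = secondProduct (b ∷ f)

  -- The term b(b - a) is a + 1 on a rise and -b on a fall. A potential growing by a from a to a + 1
  -- corrects these to 1 and 0; longer jumps meet a zero binomial.
  rises-step : ∀ a b → (β (suc a) b ≈ 0# ⊎ β (suc b) a ≈ 0#) ⊎
               + (b ∸ a) ℤ.+ triangular b ≡ + b ℤ.* (+ b ℤ.- + a) ℤ.+ triangular a
  rises-step a b = [ (λ 1+a<b → inj₁ (inj₁ (β-zero 1+a<b))) , (λ b≤1+a →
    [ (λ 1+b<a → inj₁ (inj₂ (β-zero 1+b<a))) , (λ a≤1+b → inj₂ (close b≤1+a a≤1+b)) ]′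
      (ℕ.<-≤-connex (suc b) a)) ]′ (ℕ.<-≤-connex (suc a) b)
    where
    close : ∀ {a b} → b ≤ suc a → a ≤ suc b →
            + (b ∸ a) ℤ.+ triangular b ≡ + b ℤ.* (+ b ℤ.- + a) ℤ.+ triangular a
    close {a} {b} b≤1+a a≤1+b with ℕ.<-cmp a b
    ... | tri≈ _ refl _ rewrite ℕ.n∸n≡0 a = ring (+ a) (triangular a)
      where
      ring : ∀ a t → ℤ.0ℤ ℤ.+ t ≡ a ℤ.* (a ℤ.- a) ℤ.+ t
      ring = solve-∀
    ... | tri< a<b _ _ rewrite ℕ.≤-antisym b≤1+a a<b | ℕ.m+n∸n≡m 1 a = ring (+ a) (triangular a)
      where
      ring : ∀ a t → ℤ.1ℤ ℤ.+ (a ℤ.+ t) ≡ (ℤ.1ℤ ℤ.+ a) ℤ.* (ℤ.1ℤ ℤ.+ a ℤ.- a) ℤ.+ t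
      ring = solve-∀
    ... | tri> _ _ b<a rewrite ℕ.≤-antisym a≤1+b b<a | ℕ.m≤n⇒m∸n≡0 (ℕ.n≤1+n b) = ring (+ b) (triangular b)
      where
      ring : ∀ b t → ℤ.0ℤ ℤ.+ t ≡ b ℤ.* (b ℤ.- (ℤ.1ℤ ℤ.+ b)) ℤ.+ (b ℤ.+ t)
      ring = solve-∀

  rises-energy : ∀ {l} a (f : Vec ℕ l) → firstProduct a f * secondProduct (a ∷ f) ≈ 0# ⊎
                 + rises a f ≡ energy a f ℤ.+ triangular a
  rises-energy zero          []      = inj₂ refl
  -- The potential is already 0 at height 1, so closing from there leaves no remainder; from height
  -- 2 or more the closing step has weight zero.
  rises-energy (suc zero)    []      = inj₂ refl
  rises-energy (suc (suc a)) []      = inj₁ (*-zero 1# (zero-* 1# (β-zero (s≤s (s≤s z≤n)))))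
  rises-energy a             (b ∷ f) = combine (rises-step a b) (rises-energy b f)
    where
    u = β (suc a) b
    v = β (suc b) a
    P = firstProduct b f
    S = secondProduct (b ∷ f)
    combine : (u ≈ 0# ⊎ v ≈ 0#) ⊎
              + (b ∸ a) ℤ.+ triangular b ≡ + b ℤ.* (+ b ℤ.- + a) ℤ.+ triangular a →
              P * S ≈ 0# ⊎ + rises b f ≡ energy b f ℤ.+ triangular b →
              u * P * (v * S) ≈ 0# ⊎ + rises a (b ∷ f) ≡ energy a (b ∷ f) ℤ.+ triangular a
    combine (inj₁ (inj₁ u≈0)) _ = inj₁ (zero-* (v * S) (zero-* P u≈0))
    combine (inj₁ (inj₂ v≈0)) _ = inj₁ (*-zero (u * P) (zero-* S v≈0))
    combine (inj₂ _) (inj₁ PS≈0) = inj₁ (Qr.trans (interchange u P v S) (*-zero (u * v) PS≈0))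
    combine (inj₂ e) (inj₂ e′) = inj₂ (trans (cong (ℤ._+_ (+ (b ∸ a))) e′)
      (trans (ring₁ (+ (b ∸ a)) (energy b f) (triangular b))
        (trans (cong (ℤ._+_ (energy b f)) e) (ring₂ (energy b f) (+ b ℤ.* (+ b ℤ.- + a)) (triangular a)))))
      where
      ring₁ : ∀ x y z → x ℤ.+ (y ℤ.+ z) ≡ y ℤ.+ (x ℤ.+ z)
      ring₁ = solve-∀
      ring₂ : ∀ x y z → x ℤ.+ (y ℤ.+ z) ≡ y ℤ.+ x ℤ.+ z
      ring₂ = solve-∀

  weightOf-products : ∀ {l} (f : Vec ℕ l) → weightOf f ≈ firstProduct 0 f * secondProduct f
  weightOf-products f = Qr.*-cong (product-first₀ f) (product-second f)

  pathWeight-weightOf : ∀ {l} (f : Vec ℕ l) → pathWeight 0 f ≈ X ^ rises 0 f * weightOf f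
  pathWeight-weightOf f = Qr.trans (pathWeight-products 0 f) (Qr.*-congˡ {X ^ rises 0 f}
    (Qr.trans (Qr.*-congˡ {firstProduct 0 f} (secondProduct-0∷ f)) (Qr.sym (weightOf-products f))))

  weightOf-rises : ∀ {l} (f : Vec ℕ l) → weightOf f ≈ 0# ⊎ + rises 0 f ≡ energy 0 f
  weightOf-rises f = [ (λ eq → inj₁ (Qr.trans (weightOf-products f)
      (Qr.trans (Qr.sym (Qr.*-congˡ {firstProduct 0 f} (secondProduct-0∷ f))) eq)))
    , (λ eq → inj₂ (trans eq (ℤ.+-identityʳ (energy 0 f)))) ]′ (rises-energy 0 f)

  -- The weight is palindromic of degree D, so its coefficient at N - E - j equals the one at D - (N
  -- - E - j), which is j - V because N = E + D + V. This is coefficient j after multiplication by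
  -- q^V, and V counts the rises unless the weight is zero.
  reversed-weight : ∀ {l} (f : Vec ℕ l) j →
    ι (weightOf f) (ℤ.- (j ℤ.- + consecutiveSum 0 l) ℤ.- exponentFrom 0 f) ≡ ι (pathWeight 0 f) j
  reversed-weight {l} f j = trans ([ vanishing , balanced ]′ (weightOf-rises f))
    (sym (trans (ι-cong (pathWeight-weightOf f) j) (ι-X^-* (rises 0 f) (weightOf f) j)))
    where
    w = weightOf f
    N = + consecutiveSum 0 l
    E = exponentFrom 0 f
    D = firstDegree 0 f ℤ.+ secondDegree f
    V = energy 0 f
    palindromic : Reciprocal D w w
    palindromic = reciprocal-cong (Qr.sym (weightOf-products f)) (Qr.sym (weightOf-products f))
      (reciprocal-* (firstProduct-palindromic 0 f) (secondProduct-palindromic f))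
    vanishing : w ≈ 0# → ι w (ℤ.- (j ℤ.- N) ℤ.- E) ≡ ι w (j ℤ.- + rises 0 f)
    vanishing w≈0 = trans (ι-zero w≈0 (ℤ.- (j ℤ.- N) ℤ.- E)) (sym (ι-zero w≈0 (j ℤ.- + rises 0 f)))
    balanced : + rises 0 f ≡ V → ι w (ℤ.- (j ℤ.- N) ℤ.- E) ≡ ι w (j ℤ.- + rises 0 f)
    balanced eq = trans (cong (ι w) degrees) (sym (palindromic .reflect (j ℤ.- + rises 0 f)))
      where
      ring : ∀ j E D V → ℤ.- (j ℤ.- (E ℤ.+ D ℤ.+ V ℤ.+ ℤ.0ℤ)) ℤ.- E ≡ D ℤ.- (j ℤ.- V)
      ring = solve-∀
      degrees : ℤ.- (j ℤ.- N) ℤ.- E ≡ D ℤ.- (j ℤ.- + rises 0 f)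
      degrees = trans (cong (λ n → ℤ.- (j ℤ.- n) ℤ.- E) (sym (degree-balance 0 0 f)))
        (trans (ring j E D V) (cong (λ u → D ℤ.- (j ℤ.- u)) (sym eq)))

  boxSum-motzkin : ∀ n → boxSum n (n ∸ 1) (pathWeight 0) ≈ motzkin n 0
  -- For n = 0 truncated subtraction again gives the empty vector; its single level step at height 0
  -- has weight 1, as the empty path does.
  boxSum-motzkin zero    = Qr.trans (Qr.*-identityˡ (β 1 0 * β 1 0))
    (Qr.trans (Qr.*-cong (β-0 1) (β-0 1)) (Qr.*-identityˡ 1#))
  boxSum-motzkin (suc l) = boxSum-pathWeight l 0 (ℕ.n≤1+n l)

  -- Both binomials of a level step have lower index m; symmetry turns it into 1.
  step-level : ∀ m → β (m ℕ.+ 1) 1 ^ 2 ≈ step m m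
  step-level m = begin
    β (m ℕ.+ 1) 1 ^ 2
      ≈⟨ solve 1 (λ x → x :* (x :* con 1) := con 1 :* (x :* x)) Qr.refl (β (m ℕ.+ 1) 1) ⟩
    1# * (β (m ℕ.+ 1) 1 * β (m ℕ.+ 1) 1)
      ≈⟨ Qr.*-cong (Qr.reflexive (cong (X ^_) (sym (ℕ.n∸n≡0 m)))) (Qr.*-cong (β-sym 1 m) (β-sym 1 m)) ⟩
    step m m ∎

  -- The rise supplies the factor q. Rise and fall each contribute one binomial of m + 2 over m, the
  -- other one being 1.
  step-up-down : ∀ m → X * β (m ℕ.+ 2) 2 ^ 2 ≈ step m (suc m) * step (suc m) m
  step-up-down m = begin
    X * β (m ℕ.+ 2) 2 ^ 2
      ≈⟨ Qr.*-congˡ {X} (Qr.*-cong (β-sym 2 m) (Qr.*-congʳ {1#} (β-sym 2 m))) ⟩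
    X * (d * (d * 1#))
      ≈⟨ solve 2 (λ X d → X :* (d :* (d :* con 1))
           := X :* con 1 :* (con 1 :* d) :* (con 1 :* (d :* con 1))) Qr.refl X d ⟩
    X ^ 1 * (1# * d) * (X ^ 0 * (d * 1#))
      ≈⟨ Qr.*-cong
           (Qr.*-cong (Qr.reflexive (cong (X ^_) (sym (ℕ.m+n∸n≡m 1 m))))
                      (Qr.*-congʳ {d} (Qr.sym (β-self (suc m)))))
           (Qr.*-cong (Qr.reflexive (cong (X ^_) (sym (ℕ.m≤n⇒m∸n≡0 (ℕ.n≤1+n m)))))
                      (Qr.*-congˡ {d} (Qr.sym (β-self (suc m))))) ⟩
    step m (suc m) * step (suc m) m ∎
    where d = β (2 ℕ.+ m) m

-- The coefficients of the reversed polynomials as path sums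

open Weights binom binom-gauss binom-zero

h̃-motzkin : ∀ n → h̃ n ≋ ι (motzkin n 0)
h̃-motzkin n j = trans
  (sumBox-ι n (n ∸ 1) {λ f → q^ exponent f · ι (weight f)} {pathWeight 0}
    {ℤ.- (j ℤ.- + (n ℕ.* (n ∸ 1) / 2))} {j} λ f → trans
    (cong₂ (λ N E → ι (weight f) (ℤ.- (j ℤ.- + N) ℤ.- E)) (n[n-1]/2 n) (exponent-from 0 f))
    (reversed-weight f j))
  (ι-cong (boxSum-motzkin n) j)

open MotzkinPaths ℤ[[q]] step using (continuedFraction-coeff)

theorem3p2 : JFraction≈ γ λ′ h̃
-- A path of n steps from height 0 stays below n + 1, so n + 1 levels already give the final
-- coefficient.
theorem3p2 n = suc n , λ d n<d j → trans
  (ι-cong (continuedFraction-coeff (convergent γ λ′) γ λ′ step-level step-up-down (λ a e → refl) n<d) j)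
  (sym (h̃-motzkin n j))
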